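{- Let $a,b$ be fixed positive coprime integers and $g$ a positive integer. Then $$\mu_j(g)=\sum_{k=0}^{j}(-1)^kE_kH_{g-k}\qquad\text{for }0\le j<g.$$
   Context: Lattice paths take steps in $\{(1,0),(0,1)\}$. The points of a path are the lattice points it visits, including its startpoint and endpoint. A flaw of a path is a point of the path lying strictly above the line segment joining its startpoint to its endpoint. $N_k(g)$ is the set of paths from $(0,0)$ to $(ga,gb)$ with exactly $k$ flaws, and $\mu_j(g):=|N_{j(a+b)}(g)|$ for $0\le j<g$ (so that $|N_k(g)|=\mu_j(g)$ whenever $j(a+b)\le k<(j+1)(a+b)$). For $i>0$ let $c_i:=\frac{1}{i(a+b)}\binom{i(a+b)}{ia}$. For a partition $\lambda=\langle 1^{m_1}2^{m_2}\cdots\rangle$ of a positive integer $n$ (having $m_i$ parts equal to $i$), let $l(\lambda)=\sum_i m_i$ and $c_\lambda:=\prod_{i\ge1}c_i^{m_i}/m_i!$. For $n\ge1$ define $H_n:=\sum_{\lambda\vdash n}c_\lambda$ and $E_n:=\sum_{\lambda\vdash n}(-1)^{n-l(\lambda)}c_\lambda$, and set $E_0:=1$. -}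

module Defs where

open import Data.Bool using (Bool; true; false; if_then_else_)
open import Data.Nat as ℕ using (ℕ; zero; suc; _<ᵇ_; _!)
open import Data.Nat.Combinatorics using (_C_)
open import Data.Integer using (+_)
open import Data.Rational as ℚ using (ℚ; 0ℚ; 1ℚ; _/_)
open import Data.List using (List; []; _∷_; _++_; map; filter; length; concatMap; upTo)
open import Data.Vec using (Vec; []; _∷_)
open import Relation.Nullary.Decidable using (⌊_⌋)

-- n / d as a rational; only used with d > 0 (value 0 if d = 0, never used)
frac : ℕ → ℕ → ℚ
frac n zero    = 0ℚ
frac n (suc d) = (+ n) / suc d

pow : ℚ → ℕ → ℚ
pow q zero    = 1ℚ
pow q (suc m) = q ℚ.* pow q m

sgn : ℕ → ℚ
sgn zero    = 1ℚ
sgn (suc n) = ℚ.- sgn n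

sumℚ : List ℚ → ℚ
sumℚ []       = 0ℚ
sumℚ (x ∷ xs) = x ℚ.+ sumℚ xs

-- Lattice paths.  A path from (0,0) is a list of steps:
-- true = (1,0) (east), false = (0,1) (north).

allWords : ℕ → List (List Bool)
allWords zero    = [] ∷ []
allWords (suc n) = map (true ∷_) (allWords n) ++ map (false ∷_) (allWords n)

countTrue : List Bool → ℕ
countTrue []           = 0
countTrue (true ∷ w)   = suc (countTrue w)
countTrue (false ∷ w)  = countTrue w

paths : (a b g : ℕ) → List (List Bool)
paths a b g =
  filter (λ w → countTrue w ℕ.≟ g ℕ.* a) (allWords (g ℕ.* (a ℕ.+ b)))

-- the point (x,y) is strictly above the segment from (0,0) to (X,Y)
-- iff  y * X > x * Y
above : (X Y x y : ℕ) → ℕ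
above X Y x y = if (x ℕ.* Y) <ᵇ (y ℕ.* X) then 1 else 0

-- number of points of the path (current point (x,y), remaining steps w)
-- lying strictly above the segment from (0,0) to (X,Y); every visited
-- point including start and end is examined
flawsFrom : (X Y x y : ℕ) → List Bool → ℕ
flawsFrom X Y x y []          = above X Y x y
flawsFrom X Y x y (true ∷ w)  = above X Y x y ℕ.+ flawsFrom X Y (suc x) y w
flawsFrom X Y x y (false ∷ w) = above X Y x y ℕ.+ flawsFrom X Y x (suc y) w

flaws : (a b g : ℕ) → List Bool → ℕ
flaws a b g w = flawsFrom (g ℕ.* a) (g ℕ.* b) 0 0 w

N : (a b g k : ℕ) → List (List Bool)
N a b g k = filter (λ w → flaws a b g w ℕ.≟ k) (paths a b g)

μ : (a b g j : ℕ) → ℕ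
μ a b g j = length (N a b g (j ℕ.* (a ℕ.+ b)))

c : (a b i : ℕ) → ℚ
c a b i = frac ((i ℕ.* (a ℕ.+ b)) C (i ℕ.* a)) (i ℕ.* (a ℕ.+ b))

-- Partitions of n in multiplicity form ⟨1^{m_1} 2^{m_2} ... n^{m_n}⟩:
-- a vector (m_1,...,m_n) of multiplicities with Σ i m_i = n.
-- All vectors of length k with entries in 0..B:
vecs : (k B : ℕ) → List (Vec ℕ k)
vecs zero    B = [] ∷ []
vecs (suc k) B = concatMap (λ m → map (m ∷_) (vecs k B)) (upTo (suc B))

weightFrom : ∀ {k} → ℕ → Vec ℕ k → ℕ
weightFrom s []       = 0
weightFrom s (m ∷ ms) = s ℕ.* m ℕ.+ weightFrom (suc s) ms

len : ∀ {k} → Vec ℕ k → ℕ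
len []       = 0
len (m ∷ ms) = m ℕ.+ len ms

Partitions : (n : ℕ) → List (Vec ℕ n)
Partitions n = filter (λ v → weightFrom 1 v ℕ.≟ n) (vecs n n)

cλFrom : (a b : ℕ) → ∀ {k} → ℕ → Vec ℕ k → ℚ
cλFrom a b s []       = 1ℚ
cλFrom a b s (m ∷ ms) = (pow (c a b s) m ℚ.* frac 1 (m !)) ℚ.* cλFrom a b (suc s) ms

cλ : (a b : ℕ) → ∀ {k} → Vec ℕ k → ℚ
cλ a b v = cλFrom a b 1 v

H : (a b n : ℕ) → ℚ
H a b n = sumℚ (map (cλ a b) (Partitions n))

E : (a b n : ℕ) → ℚ
E a b zero    = 1ℚ
E a b (suc n) = sumℚ (map (λ v → sgn (suc n ℕ.∸ len v) ℚ.* cλ a b v) (Partitions (suc n)))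

rhs : (a b g j : ℕ) → ℚ
rhs a b g j = sumℚ (map (λ k → (sgn k ℚ.* E a b k) ℚ.* H a b (g ℕ.∸ k)) (upTo (suc j)))

toℚ : ℕ → ℚ
toℚ n = (+ n) / 1

{-# OPTIONS --safe #-}

-- Let F k be the number of paths to (g a , g b) with k flaws. By a Sparre Andersen type
-- decomposition, F k is a convolution A k ⊛ B of the paths of length k that stay strictly
-- above the line (the endpoint excepted) with those that never go above it. Comparing
-- F (k + 1) with F k shows that they differ only if k + 1 = l (a + b), and then by
-- q l * D (g - l), where D counts the paths without flaws and - q l (l > 0) the
-- paths from (0 , 0) to (l a , l b) that are strictly above the line in between. Hence
-- μ_j(g) = Σ_{l ≤ j} q l * D (g - l), and F (g (a + b)) = 0 says that q is the inverse series
-- of D. Each μ_j(g) is attained at a + b values of k, so Σ_j μ_j(g) = g c_g, that is,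
-- q ⊛ θ D has the coefficients i c_i, where θ = X d/dX. So D and q have the
-- logarithmic derivatives ± Σ i c_i X^i, and so have the generating functions of
-- H_n and (-1)^n E_n.
module Submission where

open import Defs
open import Data.Bool using (true; false; if_then_else_; T)
open import Data.Nat as ℕ using (ℕ; zero; suc; _∸_; _≤_; _<_; z≤n; s≤s; _!; _<ᵇ_)
import Data.Nat.Properties as ℕ
import Data.Nat.Solver as ℕ
open import Data.Nat.Combinatorics using (_C_; nCk+nC[k+1]≡[n+1]C[k+1])
open import Data.Nat.Coprimality as Coprime using (Coprime; coprime-divisor; coprime-+)
open import Data.Nat.Divisibility using (_∣_; divides; ∣m+n∣m⇒∣n; n∣m*n; >⇒∤)
import Data.Integer as ℤ
import Data.Integer.Properties as ℤ
open import Data.Rational as ℚ using (ℚ; 0ℚ; 1ℚ; _+_; _*_; -_)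
import Data.Rational.Properties as ℚ
import Data.Rational.Unnormalised as ℚᵘ
import Data.Rational.Unnormalised.Properties as ℚᵘ
open import Data.Rational.Solver using (module +-*-Solver)
open import Algebra.Bundles using (CommutativeMonoid)
open import Algebra.Properties.CommutativeSemigroup
  (CommutativeMonoid.commutativeSemigroup ℚ.+-0-commutativeMonoid) using (interchange)
open import Data.List using (List; []; _∷_; _++_; map; filter; length; concatMap; upTo; applyUpTo)
open import Data.List.Properties
  using (map-upTo; filter-++; filter-accept; filter-reject; filter-none; length-++; length-map)
import Data.List.Relation.Unary.All as All
import Data.List.Relation.Unary.All.Properties as All
open import Data.Vec using (Vec; []; _∷_)
open import Data.Sum using (_⊎_; inj₁; inj₂)
open import Function using (_∘_)
open import Relation.Nullary using (¬_; contradiction; yes; no)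
open import Relation.Binary using (tri<; tri≈; tri>)
open import Relation.Binary.PropositionalEquality
open +-*-Solver using (solve; _:+_; _:*_; :-_; _:=_; con)
open ≡-Reasoning

-- The embedding of the natural numbers in the rationals

toℚᵘ-toℚ : ∀ n → ℚ.toℚᵘ (toℚ n) ℚᵘ.≃ ℚᵘ.mkℚᵘ (ℤ.+ n) 0
toℚᵘ-toℚ n = ℚ.toℚᵘ-fromℚᵘ (ℚᵘ.mkℚᵘ (ℤ.+ n) 0)

toℚ-+ : ∀ m n → toℚ (m ℕ.+ n) ≡ toℚ m + toℚ n
toℚ-+ m n = ℚ.toℚᵘ-injective
  (ℚᵘ.≃-trans (toℚᵘ-toℚ (m ℕ.+ n))
  (ℚᵘ.≃-trans (ℚᵘ.*≡* (cong (ℤ._* ℤ.+ 1) (sym (cong₂ ℤ._+_ (ℤ.*-identityʳ (ℤ.+ m)) (ℤ.*-identityʳ (ℤ.+ n))))))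
  (ℚᵘ.≃-trans (ℚᵘ.+-cong (ℚᵘ.≃-sym (toℚᵘ-toℚ m)) (ℚᵘ.≃-sym (toℚᵘ-toℚ n)))
    (ℚᵘ.≃-sym (ℚ.toℚᵘ-homo-+ (toℚ m) (toℚ n))))))

frac-* : ∀ n d → .{{ℕ.NonZero d}} → frac n d * toℚ d ≡ toℚ n
frac-* n (suc d) = ℚ.toℚᵘ-injective
  (ℚᵘ.≃-trans (ℚ.toℚᵘ-homo-* (frac n (suc d)) (toℚ (suc d)))
  (ℚᵘ.≃-trans (ℚᵘ.*-cong (ℚ.toℚᵘ-fromℚᵘ (ℚᵘ.mkℚᵘ (ℤ.+ n) d)) (toℚᵘ-toℚ (suc d)))
  (ℚᵘ.≃-trans (ℚᵘ.*≡* (begin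
      (ℤ.+ n ℤ.* ℤ.+ suc d) ℤ.* ℤ.+ 1      ≡⟨ ℤ.*-identityʳ _ ⟩
      ℤ.+ n ℤ.* ℤ.+ suc d                  ≡⟨ cong (λ z → ℤ.+ n ℤ.* ℤ.+ z) (sym (ℕ.*-identityʳ (suc d))) ⟩
      ℤ.+ n ℤ.* ℤ.+ (suc d ℕ.* 1)          ∎))
    (ℚᵘ.≃-sym (toℚᵘ-toℚ n)))))

toℚ-* : ∀ m n → toℚ (m ℕ.* n) ≡ toℚ m * toℚ n
toℚ-* zero    n = sym (ℚ.*-zeroˡ (toℚ n))
toℚ-* (suc m) n = begin
  toℚ (n ℕ.+ m ℕ.* n)          ≡⟨ toℚ-+ n (m ℕ.* n) ⟩
  toℚ n + toℚ (m ℕ.* n)        ≡⟨ cong (toℚ n +_) (toℚ-* m n) ⟩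
  toℚ n + toℚ m * toℚ n        ≡⟨ solve 2 (λ x y → x :+ y :* x := (con 1ℚ :+ y) :* x) refl (toℚ n) (toℚ m) ⟩
  (1ℚ + toℚ m) * toℚ n         ≡⟨ cong (_* toℚ n) (sym (toℚ-+ 1 m)) ⟩
  toℚ (suc m) * toℚ n          ∎

toℚ-*-cancelˡ : ∀ n → .{{ℕ.NonZero n}} → ∀ {x y} → toℚ n * x ≡ toℚ n * y → x ≡ y
toℚ-*-cancelˡ n {x} {y} eq = begin
  x                          ≡⟨ lem x ⟩
  frac 1 n * (toℚ n * x)     ≡⟨ cong (frac 1 n *_) eq ⟩
  frac 1 n * (toℚ n * y)     ≡⟨ sym (lem y) ⟩
  y                          ∎
  where
  lem : ∀ z → z ≡ frac 1 n * (toℚ n * z)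
  lem z = begin
    z                         ≡⟨ sym (ℚ.*-identityˡ z) ⟩
    1ℚ * z                    ≡⟨ cong (_* z) (sym (frac-* 1 n)) ⟩
    (frac 1 n * toℚ n) * z    ≡⟨ ℚ.*-assoc (frac 1 n) (toℚ n) z ⟩
    frac 1 n * (toℚ n * z)    ∎

-- Finite sums

∑ : ℕ → (ℕ → ℚ) → ℚ
∑ n f = sumℚ (applyUpTo f n)

∑-cong : ∀ n {f g : ℕ → ℚ} → (∀ i → i < n → f i ≡ g i) → ∑ n f ≡ ∑ n g
∑-cong zero    eq = refl
∑-cong (suc n) eq = cong₂ _+_ (eq 0 (s≤s z≤n)) (∑-cong n (λ i i<n → eq (suc i) (s≤s i<n)))

∑-zero : ∀ n {f : ℕ → ℚ} → (∀ i → i < n → f i ≡ 0ℚ) → ∑ n f ≡ 0ℚ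
∑-zero zero    eq = refl
∑-zero (suc n) eq = cong₂ _+_ (eq 0 (s≤s z≤n)) (∑-zero n (λ i i<n → eq (suc i) (s≤s i<n)))

∑-+ : ∀ n (f g : ℕ → ℚ) → ∑ n (λ i → f i + g i) ≡ ∑ n f + ∑ n g
∑-+ zero    f g = refl
∑-+ (suc n) f g = trans (cong (f 0 + g 0 +_) (∑-+ n (f ∘ suc) (g ∘ suc)))
                        (interchange (f 0) (g 0) (∑ n (f ∘ suc)) (∑ n (g ∘ suc)))

∑-*ˡ : ∀ n x (f : ℕ → ℚ) → ∑ n (λ i → x * f i) ≡ x * ∑ n f
∑-*ˡ zero    x f = sym (ℚ.*-zeroʳ x)
∑-*ˡ (suc n) x f = trans (cong (x * f 0 +_) (∑-*ˡ n x (f ∘ suc))) (sym (ℚ.*-distribˡ-+ x _ _))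

∑-const : ∀ n x → ∑ n (λ _ → x) ≡ toℚ n * x
∑-const zero    x = sym (ℚ.*-zeroˡ x)
∑-const (suc n) x = begin
  x + ∑ n (λ _ → x)          ≡⟨ cong (x +_) (∑-const n x) ⟩
  x + toℚ n * x              ≡⟨ solve 2 (λ x y → x :+ y :* x := (con 1ℚ :+ y) :* x) refl x (toℚ n) ⟩
  (1ℚ + toℚ n) * x           ≡⟨ cong (_* x) (sym (toℚ-+ 1 n)) ⟩
  toℚ (suc n) * x            ∎

∑-split : ∀ m n (f : ℕ → ℚ) → ∑ (m ℕ.+ n) f ≡ ∑ m f + ∑ n (λ i → f (m ℕ.+ i))
∑-split zero    n f = sym (ℚ.+-identityˡ _)
∑-split (suc m) n f = trans (cong (f 0 +_) (∑-split m n (f ∘ suc))) (sym (ℚ.+-assoc (f 0) _ _))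

∑-last : ∀ n (f : ℕ → ℚ) → ∑ (suc n) f ≡ ∑ n f + f n
∑-last zero    f = ℚ.+-comm (f 0) 0ℚ
∑-last (suc n) f = trans (cong (f 0 +_) (∑-last n (f ∘ suc))) (sym (ℚ.+-assoc (f 0) _ _))

∑-blocks : ∀ n c (f : ℕ → ℚ) → ∑ (n ℕ.* c) f ≡ ∑ n (λ j → ∑ c (λ r → f (j ℕ.* c ℕ.+ r)))
∑-blocks zero    c f = refl
∑-blocks (suc n) c f = begin
  ∑ (c ℕ.+ n ℕ.* c) f                                            ≡⟨ ∑-split c (n ℕ.* c) f ⟩
  ∑ c f + ∑ (n ℕ.* c) (λ i → f (c ℕ.+ i))                        ≡⟨ cong (∑ c f +_) (∑-blocks n c (λ i → f (c ℕ.+ i))) ⟩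
  ∑ c f + ∑ n (λ j → ∑ c (λ r → f (c ℕ.+ (j ℕ.* c ℕ.+ r))))
    ≡⟨ cong (∑ c f +_) (∑-cong n (λ j _ → ∑-cong c (λ r _ → cong f (sym (ℕ.+-assoc c (j ℕ.* c) r))))) ⟩
  ∑ c f + ∑ n (λ j → ∑ c (λ r → f (c ℕ.+ j ℕ.* c ℕ.+ r)))        ∎

-- `u l` occurs in the `n - l` partial sums with `l ≤ j < n`. The term `l = n` has weight 0 and is
-- kept so that the right side can be read as a convolution with some `θ D`.
∑-partialSums : ∀ n (u : ℕ → ℚ) →
  ∑ n (λ j → ∑ (suc j) u) ≡ ∑ (suc n) (λ l → toℚ (n ∸ l) * u l)
∑-partialSums zero    u = sym (trans (ℚ.+-identityʳ _) (ℚ.*-zeroˡ (u 0)))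
∑-partialSums (suc n) u = begin
  ∑ (suc n) (λ j → u 0 + ∑ j (u ∘ suc))
    ≡⟨ ∑-+ (suc n) (λ _ → u 0) (λ j → ∑ j (u ∘ suc)) ⟩
  ∑ (suc n) (λ _ → u 0) + (0ℚ + ∑ n (λ j → ∑ (suc j) (u ∘ suc)))
    ≡⟨ cong₂ _+_ (∑-const (suc n) (u 0)) (trans (ℚ.+-identityˡ _) (∑-partialSums n (u ∘ suc))) ⟩
  toℚ (suc n) * u 0 + ∑ (suc n) (λ l → toℚ (n ∸ l) * u (suc l))
    ∎

-- Power series with rational coefficients, as coefficient sequences

infix 4 _≈_
_≈_ : (f g : ℕ → ℚ) → Set
f ≈ g = ∀ n → f n ≡ g n

infixl 7 _⊛_
_⊛_ : (f g : ℕ → ℚ) → ℕ → ℚ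
(f ⊛ g) n = ∑ (suc n) (λ i → f i * g (n ∸ i))

mono : ℕ → ℚ → ℕ → ℚ
mono zero    x zero    = x
mono zero    x (suc n) = 0ℚ
mono (suc e) x zero    = 0ℚ
mono (suc e) x (suc n) = mono e x n

δ : ℕ → ℚ
δ = mono 0 1ℚ

θ : (ℕ → ℚ) → ℕ → ℚ
θ f n = toℚ n * f n

⊛-cong-terms : ∀ (f f′ g g′ : ℕ → ℚ) n →
  (∀ i j → i ℕ.+ j ≡ n → f i * g j ≡ f′ i * g′ j) → (f ⊛ g) n ≡ (f′ ⊛ g′) n
⊛-cong-terms f f′ g g′ n eq = ∑-cong (suc n) (λ i i<1+n → eq i (n ∸ i) (ℕ.m+[n∸m]≡n (ℕ.≤-pred i<1+n)))

⊛-zero-terms : ∀ (f g : ℕ → ℚ) n →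
  (∀ i j → i ℕ.+ j ≡ n → f i * g j ≡ 0ℚ) → (f ⊛ g) n ≡ 0ℚ
⊛-zero-terms f g n eq = ∑-zero (suc n) (λ i i<1+n → eq i (n ∸ i) (ℕ.m+[n∸m]≡n (ℕ.≤-pred i<1+n)))

⊛-cong-≤ : ∀ (f f′ g g′ : ℕ → ℚ) n → (∀ i → i ≤ n → f i ≡ f′ i) → (∀ i → i ≤ n → g i ≡ g′ i) →
  (f ⊛ g) n ≡ (f′ ⊛ g′) n
⊛-cong-≤ f f′ g g′ n ef eg = ⊛-cong-terms f f′ g g′ n λ i j i+j≡n →
  cong₂ _*_ (ef i (subst (i ≤_) i+j≡n (ℕ.m≤m+n i j))) (eg j (subst (j ≤_) i+j≡n (ℕ.m≤n+m j i)))

⊛-cong : ∀ (f f′ g g′ : ℕ → ℚ) → f ≈ f′ → g ≈ g′ → f ⊛ g ≈ f′ ⊛ g′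
⊛-cong f f′ g g′ ef eg n = ⊛-cong-≤ f f′ g g′ n (λ i _ → ef i) (λ i _ → eg i)

⊛-distribʳ : ∀ (f f′ g : ℕ → ℚ) → (λ i → f i + f′ i) ⊛ g ≈ (λ n → (f ⊛ g) n + (f′ ⊛ g) n)
⊛-distribʳ f f′ g n = trans
  (∑-cong (suc n) (λ i _ → ℚ.*-distribʳ-+ (g (n ∸ i)) (f i) (f′ i)))
  (∑-+ (suc n) (λ i → f i * g (n ∸ i)) (λ i → f′ i * g (n ∸ i)))

⊛-*ˡ : ∀ x (f g : ℕ → ℚ) → (λ i → x * f i) ⊛ g ≈ (λ n → x * (f ⊛ g) n)
⊛-*ˡ x f g n = trans (∑-cong (suc n) (λ i _ → ℚ.*-assoc x (f i) (g (n ∸ i))))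
                     (∑-*ˡ (suc n) x (λ i → f i * g (n ∸ i)))

⊛-last : ∀ (f g : ℕ → ℚ) n → (f ⊛ g) (suc n) ≡ (f ⊛ (g ∘ suc)) n + f (suc n) * g 0
⊛-last f g zero    = trans (cong (f 0 * g 1 +_) (ℚ.+-comm (f 1 * g 0) 0ℚ)) (sym (ℚ.+-assoc (f 0 * g 1) 0ℚ _))
⊛-last f g (suc n) = trans (cong (f 0 * g (suc (suc n)) +_) (⊛-last (f ∘ suc) g n))
                           (sym (ℚ.+-assoc (f 0 * g (suc (suc n))) _ _))

⊛-comm : ∀ (f g : ℕ → ℚ) → f ⊛ g ≈ g ⊛ f
⊛-comm f g zero    = cong (_+ 0ℚ) (ℚ.*-comm (f 0) (g 0))
⊛-comm f g (suc n) = begin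
  f 0 * g (suc n) + ((f ∘ suc) ⊛ g) n     ≡⟨ cong₂ _+_ (ℚ.*-comm (f 0) (g (suc n))) (⊛-comm (f ∘ suc) g n) ⟩
  g (suc n) * f 0 + (g ⊛ (f ∘ suc)) n     ≡⟨ ℚ.+-comm (g (suc n) * f 0) ((g ⊛ (f ∘ suc)) n) ⟩
  (g ⊛ (f ∘ suc)) n + g (suc n) * f 0     ≡⟨ sym (⊛-last g f n) ⟩
  (g ⊛ f) (suc n)                         ∎

⊛-distribˡ : ∀ (f g g′ : ℕ → ℚ) → f ⊛ (λ i → g i + g′ i) ≈ (λ n → (f ⊛ g) n + (f ⊛ g′) n)
⊛-distribˡ f g g′ n = begin
  (f ⊛ (λ i → g i + g′ i)) n     ≡⟨ ⊛-comm f (λ i → g i + g′ i) n ⟩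
  ((λ i → g i + g′ i) ⊛ f) n     ≡⟨ ⊛-distribʳ g g′ f n ⟩
  (g ⊛ f) n + (g′ ⊛ f) n         ≡⟨ cong₂ _+_ (⊛-comm g f n) (⊛-comm g′ f n) ⟩
  (f ⊛ g) n + (f ⊛ g′) n         ∎

-- The tail of `f ⊛ g` is `f 0` times the tail of `g`, plus `(f ∘ suc) ⊛ g`. Hence induction on the
-- degree, for all `f` at once.
⊛-assoc : ∀ (f g h : ℕ → ℚ) → (f ⊛ g) ⊛ h ≈ f ⊛ (g ⊛ h)
⊛-assoc f g h zero =
  solve 3 (λ x y z → (x :* y :+ con 0ℚ) :* z :+ con 0ℚ := x :* (y :* z :+ con 0ℚ) :+ con 0ℚ) refl (f 0) (g 0) (h 0)
⊛-assoc f g h (suc n) = begin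
  (f 0 * g 0 + 0ℚ) * h (suc n) + ((λ i → f 0 * g (suc i) + ((f ∘ suc) ⊛ g) i) ⊛ h) n
    ≡⟨ cong₂ _+_ (cong (_* h (suc n)) (ℚ.+-identityʳ (f 0 * g 0)))
        (⊛-distribʳ (λ i → f 0 * g (suc i)) ((f ∘ suc) ⊛ g) h n) ⟩
  f 0 * g 0 * h (suc n) + (((λ i → f 0 * g (suc i)) ⊛ h) n + (((f ∘ suc) ⊛ g) ⊛ h) n)
    ≡⟨ cong (f 0 * g 0 * h (suc n) +_) (cong₂ _+_ (⊛-*ˡ (f 0) (g ∘ suc) h n) (⊛-assoc (f ∘ suc) g h n)) ⟩
  f 0 * g 0 * h (suc n) + (f 0 * ((g ∘ suc) ⊛ h) n + ((f ∘ suc) ⊛ (g ⊛ h)) n)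
    ≡⟨ solve 5 (λ x y z u v → x :* y :* z :+ (x :* u :+ v) := x :* (y :* z :+ u) :+ v) refl
         (f 0) (g 0) (h (suc n)) _ _ ⟩
  f 0 * (g ⊛ h) (suc n) + ((f ∘ suc) ⊛ (g ⊛ h)) n
    ∎

mono-⊛ : ∀ x (g : ℕ → ℚ) n → (mono 0 x ⊛ g) n ≡ x * g n
mono-⊛ x g zero    = ℚ.+-identityʳ _
mono-⊛ x g (suc n) = trans (cong (x * g (suc n) +_) (⊛-zero-terms (λ _ → 0ℚ) g n (λ i j _ → ℚ.*-zeroˡ (g j)))) (ℚ.+-identityʳ _)

⊛-suc : ∀ (f g : ℕ → ℚ) → f 0 ≡ 0ℚ → ∀ n → (f ⊛ g) (suc n) ≡ ((f ∘ suc) ⊛ g) n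
⊛-suc f g f0 n = trans (cong (_+ ((f ∘ suc) ⊛ g) n) (trans (cong (_* g (suc n)) f0) (ℚ.*-zeroˡ (g (suc n))))) (ℚ.+-identityˡ _)

⊛-identityˡ : ∀ (g : ℕ → ℚ) → δ ⊛ g ≈ g
⊛-identityˡ g n = trans (mono-⊛ 1ℚ g n) (ℚ.*-identityˡ (g n))

mono-⊛-mono : ∀ d e x y → mono d x ⊛ mono e y ≈ mono (d ℕ.+ e) (x * y)
mono-⊛-mono zero e x y n = trans (mono-⊛ x (mono e y) n) (scale e n)
  where
  scale : ∀ e n → x * mono e y n ≡ mono e (x * y) n
  scale zero    zero    = refl
  scale zero    (suc n) = ℚ.*-zeroʳ x
  scale (suc e) zero    = ℚ.*-zeroʳ x
  scale (suc e) (suc n) = scale e n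
mono-⊛-mono (suc d) e x y zero    = trans (ℚ.+-identityʳ _) (ℚ.*-zeroˡ (mono e y 0))
mono-⊛-mono (suc d) e x y (suc n) =
  trans (⊛-suc (mono (suc d) x) (mono e y) refl n) (mono-⊛-mono d e x y n)

θ-⊛ : ∀ (f g : ℕ → ℚ) → θ (f ⊛ g) ≈ (λ n → (θ f ⊛ g) n + (f ⊛ θ g) n)
θ-⊛ f g n = begin
  toℚ n * (f ⊛ g) n
    ≡⟨ sym (∑-*ˡ (suc n) (toℚ n) (λ i → f i * g (n ∸ i))) ⟩
  ∑ (suc n) (λ i → toℚ n * (f i * g (n ∸ i)))
    ≡⟨ ∑-cong (suc n) (λ i i<1+n → leibniz i (n ∸ i) (ℕ.m+[n∸m]≡n (ℕ.≤-pred i<1+n))) ⟩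
  ∑ (suc n) (λ i → θ f i * g (n ∸ i) + f i * θ g (n ∸ i))
    ≡⟨ ∑-+ (suc n) (λ i → θ f i * g (n ∸ i)) (λ i → f i * θ g (n ∸ i)) ⟩
  (θ f ⊛ g) n + (f ⊛ θ g) n
    ∎
  where
  leibniz : ∀ i j → i ℕ.+ j ≡ n → toℚ n * (f i * g j) ≡ θ f i * g j + f i * θ g j
  leibniz i j refl = trans (cong (_* (f i * g j)) (toℚ-+ i j))
    (solve 4 (λ x y u v → (x :+ y) :* (u :* v) := (x :* u) :* v :+ u :* (y :* v)) refl (toℚ i) (toℚ j) (f i) (g j))

-- Since `κ 0 = 0`, the coefficient of degree n in `κ ⊛ f` involves only lower coefficients of `f`,
-- and division by n > 0 recovers `f n`. The bound `N` admits truncated series.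
θ-unique : ∀ N (κ f g : ℕ → ℚ) → κ 0 ≡ 0ℚ → f 0 ≡ g 0 →
  (∀ n → n ≤ N → θ f n ≡ (κ ⊛ f) n) → (∀ n → n ≤ N → θ g n ≡ (κ ⊛ g) n) →
  ∀ n → n ≤ N → f n ≡ g n
θ-unique N κ f g κ0 f0≡g0 ef eg n n≤N = go n n≤N n ℕ.≤-refl
  where
  go : ∀ n → n ≤ N → ∀ i → i ≤ n → f i ≡ g i
  go n       n≤N zero    i≤n       = f0≡g0
  go (suc n) n≤N (suc i) (s≤s i≤n) = toℚ-*-cancelˡ (suc i) (begin
    θ f (suc i)                ≡⟨ ef (suc i) 1+i≤N ⟩
    (κ ⊛ f) (suc i)            ≡⟨ ⊛-suc κ f κ0 i ⟩
    ((κ ∘ suc) ⊛ f) i          ≡⟨ ⊛-cong-≤ (κ ∘ suc) (κ ∘ suc) f g i (λ _ _ → refl)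
                                     (λ l l≤i → go n (ℕ.≤-trans (ℕ.n≤1+n n) n≤N) l (ℕ.≤-trans l≤i i≤n)) ⟩
    ((κ ∘ suc) ⊛ g) i          ≡⟨ sym (⊛-suc κ g κ0 i) ⟩
    (κ ⊛ g) (suc i)            ≡⟨ sym (eg (suc i) 1+i≤N) ⟩
    θ g (suc i)                ∎)
    where
    1+i≤N : suc i ≤ N
    1+i≤N = ℕ.≤-trans (s≤s i≤n) n≤N

mono-≡ : ∀ e x → mono e x e ≡ x
mono-≡ zero    x = refl
mono-≡ (suc e) x = mono-≡ e x

mono-≢ : ∀ e x n → n ≢ e → mono e x n ≡ 0ℚ
mono-≢ zero    x zero    n≢e = contradiction refl n≢e
mono-≢ zero    x (suc n) n≢e = refl
mono-≢ (suc e) x zero    n≢e = refl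
mono-≢ (suc e) x (suc n) n≢e = mono-≢ e x n (n≢e ∘ cong suc)

mono-⊛-+ : ∀ e x (g : ℕ → ℚ) n → (mono e x ⊛ g) (e ℕ.+ n) ≡ x * g n
mono-⊛-+ zero    x g n = mono-⊛ x g n
mono-⊛-+ (suc e) x g n = trans (⊛-suc (mono (suc e) x) g refl (e ℕ.+ n)) (mono-⊛-+ e x g n)

-- With only one nonzero term in the convolution, `f` may be replaced by its monomial of degree `i`.
⊛-single : ∀ (f g : ℕ → ℚ) i j → (∀ k l → k ℕ.+ l ≡ i ℕ.+ j → k ≢ i → f k * g l ≡ 0ℚ) →
  (f ⊛ g) (i ℕ.+ j) ≡ f i * g j
⊛-single f g i j eq = trans (⊛-cong-terms f (mono i (f i)) g g (i ℕ.+ j) terms) (mono-⊛-+ i (f i) g j)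
  where
  terms : ∀ k l → k ℕ.+ l ≡ i ℕ.+ j → f k * g l ≡ mono i (f i) k * g l
  terms k l k+l≡i+j with k ℕ.≟ i
  ... | yes refl = cong (_* g l) (sym (mono-≡ k (f k)))
  ... | no  k≢i  = trans (eq k l k+l≡i+j k≢i)
                     (sym (trans (cong (_* g l) (mono-≢ i (f i) k k≢i)) (ℚ.*-zeroˡ (g l))))

θ-mono : ∀ e x n → θ (mono e x) n ≡ mono e (toℚ e * x) n
θ-mono e x n with n ℕ.≟ e
... | yes refl = trans (cong (toℚ n *_) (mono-≡ n x)) (sym (mono-≡ n (toℚ n * x)))
... | no n≢e   = trans (cong (toℚ n *_) (mono-≢ e x n n≢e))
                   (trans (ℚ.*-zeroʳ (toℚ n)) (sym (mono-≢ e (toℚ e * x) n n≢e)))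

mono-0ℚ : ∀ e n → mono e 0ℚ n ≡ 0ℚ
mono-0ℚ zero    zero    = refl
mono-0ℚ zero    (suc n) = refl
mono-0ℚ (suc e) zero    = refl
mono-0ℚ (suc e) (suc n) = mono-0ℚ e n

⊛-zeroˡ : ∀ (g : ℕ → ℚ) n → ((λ _ → 0ℚ) ⊛ g) n ≡ 0ℚ
⊛-zeroˡ g n = ⊛-zero-terms (λ _ → 0ℚ) g n (λ i j _ → ℚ.*-zeroˡ (g j))

⊛-zeroʳ : ∀ (f : ℕ → ℚ) n → (f ⊛ (λ _ → 0ℚ)) n ≡ 0ℚ
⊛-zeroʳ f n = ⊛-zero-terms f (λ _ → 0ℚ) n (λ i j _ → ℚ.*-zeroʳ (f i))

⊛-∑ʳ : ∀ N (f : ℕ → ℚ) (h : ℕ → ℕ → ℚ) n →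
  (f ⊛ (λ i → ∑ N (λ m → h m i))) n ≡ ∑ N (λ m → (f ⊛ h m) n)
⊛-∑ʳ zero    f h n = ⊛-zeroʳ f n
⊛-∑ʳ (suc N) f h n = trans (⊛-distribˡ f (h 0) (λ i → ∑ N (λ m → h (suc m) i)) n)
                           (cong ((f ⊛ h 0) n +_) (⊛-∑ʳ N f (h ∘ suc) n))

⊛-swap : ∀ (f g h : ℕ → ℚ) → f ⊛ (g ⊛ h) ≈ g ⊛ (f ⊛ h)
⊛-swap f g h n = begin
  (f ⊛ (g ⊛ h)) n    ≡⟨ ⊛-assoc f g h n ⟨
  ((f ⊛ g) ⊛ h) n    ≡⟨ ⊛-cong (f ⊛ g) (g ⊛ f) h h (⊛-comm f g) (λ _ → refl) n ⟩
  ((g ⊛ f) ⊛ h) n    ≡⟨ ⊛-assoc g f h n ⟩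
  (g ⊛ (f ⊛ h)) n    ∎

-- Logarithmic derivatives of a series and of its inverse

module _ (D q κ : ℕ → ℚ) (qD : q ⊛ D ≈ δ) (qθD : q ⊛ θ D ≈ κ) where

  -- As `q` is the inverse of `D`, the hypothesis `qθD` makes `κ` the logarithmic derivative of `D`.
  θ-of-inverse : θ D ≈ κ ⊛ D
  θ-of-inverse n = begin
    θ D n                  ≡⟨ ⊛-identityˡ (θ D) n ⟨
    (δ ⊛ θ D) n            ≡⟨ ⊛-cong (D ⊛ q) δ (θ D) (θ D) (λ i → trans (⊛-comm D q i) (qD i)) (λ _ → refl) n ⟨
    ((D ⊛ q) ⊛ θ D) n      ≡⟨ ⊛-assoc D q (θ D) n ⟩
    (D ⊛ (q ⊛ θ D)) n      ≡⟨ ⊛-cong D D (q ⊛ θ D) κ (λ _ → refl) qθD n ⟩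
    (D ⊛ κ) n              ≡⟨ ⊛-comm D κ n ⟩
    (κ ⊛ D) n              ∎

  -- By the Leibniz rule the sum of `θ q ⊛ D` and `q ⊛ θ D` is `θ δ`, which vanishes.
  θq⊛D : ∀ n → (θ q ⊛ D) n ≡ - κ n
  θq⊛D n = begin
    u                            ≡⟨ solve 2 (λ u v → u := (u :+ v) :+ (:- v)) refl u v ⟩
    u + v + - v                  ≡⟨ cong₂ (λ y z → y + - z) (trans (sym (θ-⊛ q D n)) (trans (cong (toℚ n *_) (qD n)) (θδ n))) (qθD n) ⟩
    0ℚ + - κ n                   ≡⟨ ℚ.+-identityˡ (- κ n) ⟩
    - κ n                        ∎
    where
    u v : ℚ
    u = (θ q ⊛ D) n
    v = (q ⊛ θ D) n
    θδ : ∀ n → θ δ n ≡ 0ℚ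
    θδ zero    = refl
    θδ (suc n) = ℚ.*-zeroʳ (toℚ (suc n))

  θ-inverse : θ q ≈ (λ n → - κ n) ⊛ q
  θ-inverse n = begin
    θ q n                  ≡⟨ ⊛-identityˡ (θ q) n ⟨
    (δ ⊛ θ q) n            ≡⟨ ⊛-comm δ (θ q) n ⟩
    (θ q ⊛ δ) n            ≡⟨ ⊛-cong (θ q) (θ q) (D ⊛ q) δ (λ _ → refl) (λ i → trans (⊛-comm D q i) (qD i)) n ⟨
    (θ q ⊛ (D ⊛ q)) n      ≡⟨ ⊛-assoc (θ q) D q n ⟨
    ((θ q ⊛ D) ⊛ q) n      ≡⟨ ⊛-cong (θ q ⊛ D) (λ n → - κ n) q q θq⊛D (λ _ → refl) n ⟩
    ((λ n → - κ n) ⊛ q) n  ∎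

-- Lattice paths by number of flaws

shift : (ℕ → ℚ) → ℕ → ℚ
shift f zero    = 0ℚ
shift f (suc i) = f i

-- Multiplication by 1 + X: adjoins one step, tracking the number of east steps.
W : (ℕ → ℚ) → ℕ → ℚ
W f i = f i + shift f i

W-cong : ∀ (f g : ℕ → ℚ) → f ≈ g → W f ≈ W g
W-cong f g eq zero    = cong (_+ 0ℚ) (eq 0)
W-cong f g eq (suc i) = cong₂ _+_ (eq (suc i)) (eq i)

W-zero : ∀ (f : ℕ → ℚ) → (∀ i → f i ≡ 0ℚ) → ∀ i → W f i ≡ 0ℚ
W-zero f eq zero    = cong (_+ 0ℚ) (eq 0)
W-zero f eq (suc i) = cong₂ _+_ (eq (suc i)) (eq i)

∑-W : ∀ n (f : ℕ → ℕ → ℚ) x → ∑ n (λ k → W (f k) x) ≡ W (λ y → ∑ n (λ k → f k y)) x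
∑-W n f zero    = trans (∑-+ n (λ k → f k 0) (λ _ → 0ℚ))
                        (cong (∑ n (λ k → f k 0) +_) (∑-zero n (λ _ _ → refl)))
∑-W n f (suc x) = ∑-+ n (λ k → f k (suc x)) (λ k → f k x)

W-⊛ : ∀ (f g : ℕ → ℚ) → W f ⊛ g ≈ W (f ⊛ g)
W-⊛ f g n = trans (⊛-distribʳ f (shift f) g n) (cong ((f ⊛ g) n +_) (shift-⊛ n))
  where
  shift-⊛ : shift f ⊛ g ≈ shift (f ⊛ g)
  shift-⊛ zero    = trans (ℚ.+-identityʳ (0ℚ * g 0)) (ℚ.*-zeroˡ (g 0))
  shift-⊛ (suc n) = ⊛-suc (shift f) g refl n

⊛-W : ∀ (f g : ℕ → ℚ) → f ⊛ W g ≈ W (f ⊛ g)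
⊛-W f g n = begin
  (f ⊛ W g) n   ≡⟨ ⊛-comm f (W g) n ⟩
  (W g ⊛ f) n   ≡⟨ W-⊛ g f n ⟩
  W (g ⊛ f) n   ≡⟨ W-cong (g ⊛ f) (f ⊛ g) (⊛-comm g f) n ⟩
  W (f ⊛ g) n   ∎

pascal : ∀ n x → toℚ (suc n C x) ≡ W (λ y → toℚ (n C y)) x
pascal n zero    = refl
pascal n (suc x) = begin
  toℚ (suc n C suc x)             ≡⟨ cong toℚ (sym (nCk+nC[k+1]≡[n+1]C[k+1] n x)) ⟩
  toℚ (n C x ℕ.+ n C suc x)       ≡⟨ toℚ-+ (n C x) (n C suc x) ⟩
  toℚ (n C x) + toℚ (n C suc x)   ≡⟨ ℚ.+-comm (toℚ (n C x)) (toℚ (n C suc x)) ⟩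
  toℚ (n C suc x) + toℚ (n C x)   ∎

-- Reading a path from its current point, (n , x) records that n steps remain, x of them
-- east; the current point is above the line of slope b / a through the endpoint iff
-- n * a < x * c′, where c′ = a + b.
module Ballot (a e : ℕ) (coprime : Coprime (suc e) a) where

  c′ : ℕ
  c′ = suc e

  branch : ℕ → ℕ → ℚ → ℚ → ℚ
  branch n x u v = if n ℕ.* a <ᵇ x ℕ.* c′ then u else v

  branch-< : ∀ {n x u v} → n ℕ.* a < x ℕ.* c′ → branch n x u v ≡ u
  branch-< {n} {x} lt with n ℕ.* a <ᵇ x ℕ.* c′ | ℕ.<⇒<ᵇ lt
  ... | true | _ = refl

  branch-≥ : ∀ {n x u v} → x ℕ.* c′ ≤ n ℕ.* a → branch n x u v ≡ v
  branch-≥ {n} {x} ge with n ℕ.* a <ᵇ x ℕ.* c′ in eq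
  ... | true  = contradiction (ℕ.<ᵇ⇒< _ _ (subst T (sym eq) _)) (ℕ.≤⇒≯ ge)
  ... | false = refl

  -- F k n x counts the completions with k flaws. A k and B m count those whose current point,
  -- at every time before the end, is above the line, respectively is not above it.
  -- K k counts the words whose first step leaves a point not above the line for a completion
  -- counted by A k.
  F : ℕ → ℕ → ℕ → ℚ
  F zero    zero    x = δ x
  F (suc k) zero    x = 0ℚ
  F zero    (suc n) x = branch (suc n) x 0ℚ (W (F zero n) x)
  F (suc k) (suc n) x = branch (suc n) x (W (F k n) x) (W (F (suc k) n) x)

  A : ℕ → ℕ → ℚ
  A zero    x = δ x
  A (suc k) x = branch (suc k) x (W (A k) x) 0ℚ

  B : ℕ → ℕ → ℚ
  B zero    x = δ x
  B (suc m) x = branch (suc m) x 0ℚ (W (B m) x)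

  K : ℕ → ℕ → ℚ
  K k x = branch (suc k) x 0ℚ (W (A k) x)

  F-≥ : ∀ k n x → x ℕ.* c′ ≤ suc n ℕ.* a → F k (suc n) x ≡ W (F k n) x
  F-≥ zero    n x ge = branch-≥ {suc n} {x} ge
  F-≥ (suc k) n x ge = branch-≥ {suc n} {x} ge

  -- With `n` steps left only `n` points can be flaws, since the endpoint is not one.
  F-zero : ∀ k n → n < k → ∀ x → F k n x ≡ 0ℚ
  F-zero (suc k) zero    n<k       x = refl
  F-zero (suc k) (suc n) (s≤s n<k) x with suc n ℕ.* a ℕ.<? x ℕ.* c′
  ... | yes lt = trans (branch-< {suc n} {x} lt) (W-zero (F k n) (F-zero k n n<k) x)
  ... | no ¬lt = trans (branch-≥ {suc n} {x} (ℕ.≮⇒≥ ¬lt)) (W-zero (F (suc k) n) (F-zero (suc k) n (ℕ.m<n⇒m<1+n n<k)) x)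

  A-≥ : ∀ k x → x ℕ.* c′ ≤ suc k ℕ.* a → A (suc k) x ≡ 0ℚ
  A-≥ k x ge = branch-≥ {suc k} {x} ge

  -- The strict inequality rules out `k = 0`, where the empty word is counted although its point is
  -- not above the line.
  A-> : ∀ k x → x ℕ.* c′ < k ℕ.* a → A k x ≡ 0ℚ
  A-> (suc k) x gt = A-≥ k x (ℕ.<⇒≤ gt)

  B-< : ∀ m x → m ℕ.* a < x ℕ.* c′ → B m x ≡ 0ℚ
  B-< zero    (suc x) lt = refl
  B-< (suc m) x       lt = branch-< {suc m} {x} lt

  -- The function (n , x) ↦ n * a - x * c′ is additive.
  split-< : ∀ {k m i j n x} → k ℕ.+ m ≡ n → i ℕ.+ j ≡ x → n ℕ.* a < x ℕ.* c′ →
    i ℕ.* c′ ≤ k ℕ.* a → m ℕ.* a < j ℕ.* c′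
  split-< {k} {m} {i} {j} refl refl lt ge = ℕ.≰⇒> λ j≤m → ℕ.<⇒≱ lt
    (subst₂ _≤_ (sym (ℕ.*-distribʳ-+ c′ i j)) (sym (ℕ.*-distribʳ-+ a k m)) (ℕ.+-mono-≤ ge j≤m))

  split-≥ : ∀ {k m i j n x} → k ℕ.+ m ≡ n → i ℕ.+ j ≡ x → x ℕ.* c′ ≤ n ℕ.* a →
    m ℕ.* a < j ℕ.* c′ → i ℕ.* c′ < k ℕ.* a
  split-≥ {k} {m} {i} {j} refl refl ge lt = ℕ.≰⇒> λ k≤i → ℕ.≤⇒≯ ge
    (subst₂ _<_ (sym (ℕ.*-distribʳ-+ a k m)) (sym (ℕ.*-distribʳ-+ c′ i j)) (ℕ.+-mono-≤-< k≤i lt))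

  split-> : ∀ {k m i j n x} → k ℕ.+ m ≡ n → i ℕ.+ j ≡ x → x ℕ.* c′ ≡ n ℕ.* a →
    i ℕ.* c′ < k ℕ.* a → m ℕ.* a < j ℕ.* c′
  split-> {k} {m} {i} {j} refl refl eq lt = ℕ.≰⇒> λ j≤m → ℕ.<⇒≢
    (subst₂ _<_ (sym (ℕ.*-distribʳ-+ c′ i j)) (sym (ℕ.*-distribʳ-+ a k m)) (ℕ.+-mono-<-≤ lt j≤m)) eq

  zeroˡ : ∀ {x} y → x ≡ 0ℚ → x * y ≡ 0ℚ
  zeroˡ y refl = ℚ.*-zeroˡ y

  zeroʳ : ∀ x {y} → y ≡ 0ℚ → x * y ≡ 0ℚ
  zeroʳ x refl = ℚ.*-zeroʳ x

  -- The factors `A (suc k) i` and `W (A k) i` can differ only where `(suc k , i)` is not above the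
  -- line. By additivity `(m , j)` is then above it, and `B m j` vanishes.
  A-step : ∀ k m x → suc (k ℕ.+ m) ℕ.* a < x ℕ.* c′ → (A (suc k) ⊛ B m) x ≡ (W (A k) ⊛ B m) x
  A-step k m x lt = ⊛-cong-terms (A (suc k)) (W (A k)) (B m) (B m) x terms
    where
    terms : ∀ i j → i ℕ.+ j ≡ x → A (suc k) i * B m j ≡ W (A k) i * B m j
    terms i j i+j≡x with suc k ℕ.* a ℕ.<? i ℕ.* c′
    ... | yes lt′ = cong (_* B m j) (branch-< {suc k} {i} lt′)
    ... | no ¬lt′ = trans (zeroʳ (A (suc k) i) Bj≡0) (sym (zeroʳ (W (A k) i) Bj≡0))
      where
      Bj≡0 : B m j ≡ 0ℚ
      Bj≡0 = B-< m j (split-< {suc k} {m} {i} {j} refl i+j≡x lt (ℕ.≮⇒≥ ¬lt′))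

  -- Dually, the factors can differ only where `(suc m , j)` is above the line. Then `(k , i)` is
  -- strictly below it, and `A k i` vanishes.
  B-step : ∀ k m x → x ℕ.* c′ ≤ suc (k ℕ.+ m) ℕ.* a → (A k ⊛ B (suc m)) x ≡ (A k ⊛ W (B m)) x
  B-step k m x ge = ⊛-cong-terms (A k) (A k) (B (suc m)) (W (B m)) x terms
    where
    terms : ∀ i j → i ℕ.+ j ≡ x → A k i * B (suc m) j ≡ A k i * W (B m) j
    terms i j i+j≡x with suc m ℕ.* a ℕ.<? j ℕ.* c′
    ... | no ¬lt = cong (A k i *_) (branch-≥ {suc m} {j} (ℕ.≮⇒≥ ¬lt))
    ... | yes lt = trans (zeroˡ (B (suc m) j) Ai≡0) (sym (zeroˡ (W (B m) j) Ai≡0))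
      where
      Ai≡0 : A k i ≡ 0ℚ
      Ai≡0 = A-> k i (split-≥ {k} {suc m} {i} {j} (ℕ.+-suc k m) i+j≡x ge lt)

  -- Both sides satisfy the recurrence defining F: a step is split off the factor A k at points
  -- above the line, and off the factor B m at the others.
  F-⊛ : ∀ k m → F k (k ℕ.+ m) ≈ A k ⊛ B m
  F-⊛-< : ∀ k m x → suc (k ℕ.+ m) ℕ.* a < x ℕ.* c′ → F (suc k) (suc (k ℕ.+ m)) x ≡ (A (suc k) ⊛ B m) x

  F-⊛ zero    zero    x = sym (⊛-identityˡ δ x)
  F-⊛ zero    (suc m) x with suc m ℕ.* a ℕ.<? x ℕ.* c′
  ... | yes lt = trans (branch-< {suc m} {x} lt)
                   (sym (trans (⊛-identityˡ (B (suc m)) x) (branch-< {suc m} {x} lt)))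
  ... | no ¬lt = begin
    F 0 (suc m) x             ≡⟨ F-≥ 0 m x (ℕ.≮⇒≥ ¬lt) ⟩
    W (F 0 m) x               ≡⟨ W-cong (F 0 m) (A 0 ⊛ B m) (F-⊛ 0 m) x ⟩
    W (A 0 ⊛ B m) x           ≡⟨ ⊛-W (A 0) (B m) x ⟨
    (A 0 ⊛ W (B m)) x         ≡⟨ B-step 0 m x (ℕ.≮⇒≥ ¬lt) ⟨
    (A 0 ⊛ B (suc m)) x       ∎
  F-⊛ (suc k) m x with suc (k ℕ.+ m) ℕ.* a ℕ.<? x ℕ.* c′
  F-⊛ (suc k) m       x | yes lt = F-⊛-< k m x lt
  -- Both sides vanish: after the first step fewer than `suc k` steps are left for `suc k` flaws,
  -- and `A (suc k)` is zero at points not above the line.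
  F-⊛ (suc k) zero    x | no ¬lt = trans
    (trans (F-≥ (suc k) (k ℕ.+ 0) x (ℕ.≮⇒≥ ¬lt))
      (W-zero (F (suc k) (k ℕ.+ 0)) (F-zero (suc k) (k ℕ.+ 0) (s≤s (ℕ.≤-reflexive (ℕ.+-identityʳ k)))) x))
    (sym (trans (⊛-comm (A (suc k)) δ x) (trans (⊛-identityˡ (A (suc k)) x)
      (A-≥ k x (subst (λ z → x ℕ.* c′ ≤ suc z ℕ.* a) (ℕ.+-identityʳ k) (ℕ.≮⇒≥ ¬lt))))))
  F-⊛ (suc k) (suc m) x | no ¬lt = begin
    F (suc k) (suc (k ℕ.+ suc m)) x    ≡⟨ F-≥ (suc k) (k ℕ.+ suc m) x (ℕ.≮⇒≥ ¬lt) ⟩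
    W (F (suc k) (k ℕ.+ suc m)) x      ≡⟨ cong (λ n → W (F (suc k) n) x) (ℕ.+-suc k m) ⟩
    W (F (suc k) (suc k ℕ.+ m)) x      ≡⟨ W-cong (F (suc k) (suc k ℕ.+ m)) (A (suc k) ⊛ B m) (F-⊛ (suc k) m) x ⟩
    W (A (suc k) ⊛ B m) x              ≡⟨ ⊛-W (A (suc k)) (B m) x ⟨
    (A (suc k) ⊛ W (B m)) x            ≡⟨ B-step (suc k) m x (subst (λ z → x ℕ.* c′ ≤ suc z ℕ.* a) (ℕ.+-suc k m) (ℕ.≮⇒≥ ¬lt)) ⟨
    (A (suc k) ⊛ B (suc m)) x          ∎

  F-⊛-< k m x lt = begin
    F (suc k) (suc (k ℕ.+ m)) x        ≡⟨ branch-< {suc (k ℕ.+ m)} {x} lt ⟩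
    W (F k (k ℕ.+ m)) x                ≡⟨ W-cong (F k (k ℕ.+ m)) (A k ⊛ B m) (F-⊛ k m) x ⟩
    W (A k ⊛ B m) x                    ≡⟨ W-⊛ (A k) (B m) x ⟨
    (W (A k) ⊛ B m) x                  ≡⟨ A-step k m x lt ⟨
    (A (suc k) ⊛ B m) x                ∎

  -- Summing the recurrence over `k` forgets the flaws: above the line `k` is merely shifted,
  -- elsewhere the surplus last term is zero by `F-zero`. Pascal's rule remains.
  F-total : ∀ n x → ∑ (suc n) (λ k → F k n x) ≡ toℚ (n C x)
  F-total zero zero    = refl
  F-total zero (suc x) = refl
  F-total (suc n) x = begin
    ∑ (suc (suc n)) (λ k → F k (suc n) x)          ≡⟨ step ⟩
    ∑ (suc n) (λ k → W (F k n) x)                  ≡⟨ ∑-W (suc n) (λ k → F k n) x ⟩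
    W (λ y → ∑ (suc n) (λ k → F k n y)) x          ≡⟨ W-cong _ (λ y → toℚ (n C y)) (F-total n) x ⟩
    W (λ y → toℚ (n C y)) x                        ≡⟨ pascal n x ⟨
    toℚ (suc n C x)                                ∎
    where
    step : ∑ (suc (suc n)) (λ k → F k (suc n) x) ≡ ∑ (suc n) (λ k → W (F k n) x)
    step with suc n ℕ.* a ℕ.<? x ℕ.* c′
    ... | yes lt = trans (cong₂ _+_ (branch-< {suc n} {x} lt) (∑-cong (suc n) {g = λ k → W (F k n) x} (λ k _ → branch-< {suc n} {x} {v = W (F (suc k) n) x} lt)))
                         (ℚ.+-identityˡ (∑ (suc n) (λ k → W (F k n) x)))
    ... | no ¬lt = begin
      ∑ (suc (suc n)) (λ k → F k (suc n) x)        ≡⟨ ∑-cong (suc (suc n)) (λ k _ → F-≥ k n x (ℕ.≮⇒≥ ¬lt)) ⟩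
      ∑ (suc (suc n)) (λ k → W (F k n) x)          ≡⟨ ∑-last (suc n) (λ k → W (F k n) x) ⟩
      ∑ (suc n) (λ k → W (F k n) x) + W (F (suc n) n) x
        ≡⟨ cong (∑ (suc n) (λ k → W (F k n) x) +_) (W-zero (F (suc n) n) (F-zero (suc n) n ℕ.≤-refl) x) ⟩
      ∑ (suc n) (λ k → W (F k n) x) + 0ℚ           ≡⟨ ℚ.+-identityʳ _ ⟩
      ∑ (suc n) (λ k → W (F k n) x)                ∎

  -- Jumps of the path count as the number of flaws grows

  D : ℕ → ℚ
  D l = B (l ℕ.* c′) (l ℕ.* a)

  -- `K k` counts words of length `suc k`, so the index `e + l * c′` stands for words of length
  -- `suc l * c′`. With `suc l * a` east steps these start on the line.
  q : ℕ → ℚ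
  q zero    = 1ℚ
  q (suc l) = - K (e ℕ.+ l ℕ.* c′) (suc l ℕ.* a)

  module _ (g : ℕ) where

    F∘ : ℕ → ℚ
    F∘ k = F k (g ℕ.* c′) (g ℕ.* a)

    [ga]c≡[gc]a : (g ℕ.* a) ℕ.* c′ ≡ (g ℕ.* c′) ℕ.* a
    [ga]c≡[gc]a = trans (ℕ.*-assoc g a c′) (trans (cong (g ℕ.*_) (ℕ.*-comm a c′)) (sym (ℕ.*-assoc g c′ a)))

    -- The start is on the line, so `B-step` frees one step from the factor `B (suc m)`, and `W`
    -- moves it to `A k`. A step put before a word counted by `A k` leads back to a point above the
    -- line, giving `A (suc k)`, or not, giving `K k`.
    F∘-step : ∀ k m → suc (k ℕ.+ m) ≡ g ℕ.* c′ → F∘ k ≡ F∘ (suc k) + (K k ⊛ B m) (g ℕ.* a)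
    F∘-step k m eq = begin
      F k (g ℕ.* c′) x                                   ≡⟨ cong (λ n → F k n x) (trans (sym eq) (sym (ℕ.+-suc k m))) ⟩
      F k (k ℕ.+ suc m) x                                ≡⟨ F-⊛ k (suc m) x ⟩
      (A k ⊛ B (suc m)) x                                ≡⟨ B-step k m x (ℕ.≤-reflexive xc≡na) ⟩
      (A k ⊛ W (B m)) x                                  ≡⟨ trans (⊛-W (A k) (B m) x) (sym (W-⊛ (A k) (B m) x)) ⟩
      (W (A k) ⊛ B m) x                                  ≡⟨ ⊛-cong (W (A k)) (λ i → A (suc k) i + K k i) (B m) (B m) W-split (λ _ → refl) x ⟩
      ((λ i → A (suc k) i + K k i) ⊛ B m) x              ≡⟨ ⊛-distribʳ (A (suc k)) (K k) (B m) x ⟩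
      (A (suc k) ⊛ B m) x + (K k ⊛ B m) x                ≡⟨ cong (_+ (K k ⊛ B m) x) (F-⊛ (suc k) m x) ⟨
      F (suc k) (suc (k ℕ.+ m)) x + (K k ⊛ B m) x        ≡⟨ cong (λ n → F (suc k) n x + (K k ⊛ B m) x) eq ⟩
      F (suc k) (g ℕ.* c′) x + (K k ⊛ B m) x             ∎
      where
      x : ℕ
      x = g ℕ.* a
      xc≡na : x ℕ.* c′ ≡ suc (k ℕ.+ m) ℕ.* a
      xc≡na = trans [ga]c≡[gc]a (cong (ℕ._* a) (sym eq))
      W-split : ∀ i → W (A k) i ≡ A (suc k) i + K k i
      W-split i with suc k ℕ.* a ℕ.<? i ℕ.* c′
      ... | yes lt = sym (trans (cong₂ _+_ (branch-< {suc k} {i} lt) (branch-< {suc k} {i} lt)) (ℚ.+-identityʳ _))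
      ... | no ¬lt = sym (trans (cong₂ _+_ (branch-≥ {suc k} {i} (ℕ.≮⇒≥ ¬lt)) (branch-≥ {suc k} {i} (ℕ.≮⇒≥ ¬lt))) (ℚ.+-identityˡ _))

    -- A nonzero product needs both `(suc k , i)` and `(m , j)` not above the line. Their sum is on
    -- the line, so both are on it, which `off` excludes.
    K*B-zero : ∀ k m → suc (k ℕ.+ m) ≡ g ℕ.* c′ → ∀ i j → i ℕ.+ j ≡ g ℕ.* a →
      i ℕ.* c′ ≢ suc k ℕ.* a → K k i * B m j ≡ 0ℚ
    K*B-zero k m eq i j i+j≡ga off with ℕ.<-cmp (i ℕ.* c′) (suc k ℕ.* a)
    ... | tri< lt _ _ = zeroʳ (K k i) (B-< m j (split-> {suc k} {m} {i} {j} eq i+j≡ga [ga]c≡[gc]a lt))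
    ... | tri≈ _ ic≡ka _ = contradiction ic≡ka off
    ... | tri> _ _ gt = zeroˡ (B m j) (branch-< {suc k} {i} gt)

    -- A surviving term would have `i * c′ = suc k * a`, and `c′`, being coprime to `a`, would
    -- divide `suc k`.
    F∘-const : ∀ k m → suc (k ℕ.+ m) ≡ g ℕ.* c′ → ¬ c′ ∣ suc k → F∘ k ≡ F∘ (suc k)
    F∘-const k m eq c∤k = trans (F∘-step k m eq)
      (trans (cong (F∘ (suc k) +_) (⊛-zero-terms (K k) (B m) (g ℕ.* a) terms)) (ℚ.+-identityʳ (F∘ (suc k))))
      where
      terms : ∀ i j → i ℕ.+ j ≡ g ℕ.* a → K k i * B m j ≡ 0ℚ
      terms i j i+j≡ga = K*B-zero k m eq i j i+j≡ga
        (λ ic≡ka → c∤k (coprime-divisor coprime (divides i (trans (ℕ.*-comm a (suc k)) (sym ic≡ka)))))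

    -- Here `suc k` is `suc l * c′`, and the only term on the line is `i = suc l * a`, which
    -- contributes `- q (suc l) * D l′`.
    F∘-jump : ∀ l l′ → suc l ℕ.+ l′ ≡ g → F∘ (e ℕ.+ l ℕ.* c′) + q (suc l) * D l′ ≡ F∘ (suc l ℕ.* c′)
    F∘-jump l l′ refl = begin
      F∘ k + - u * v                         ≡⟨ cong (_+ - u * v) (F∘-step k (l′ ℕ.* c′) eq) ⟩
      F∘ (suc k) + (K k ⊛ B (l′ ℕ.* c′)) (g ℕ.* a) + - u * v
        ≡⟨ cong (λ z → F∘ (suc k) + z + - u * v) (trans
            (cong (K k ⊛ B (l′ ℕ.* c′)) (ℕ.*-distribʳ-+ a (suc l) l′))
            (⊛-single (K k) (B (l′ ℕ.* c′)) (suc l ℕ.* a) (l′ ℕ.* a) terms)) ⟩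
      F∘ (suc k) + u * v + - u * v           ≡⟨ solve 3 (λ x y z → x :+ y :* z :+ (:- y) :* z := x) refl (F∘ (suc k)) u v ⟩
      F∘ (suc k)                             ∎
      where
      k : ℕ
      k = e ℕ.+ l ℕ.* c′
      u v : ℚ
      u = K k (suc l ℕ.* a)
      v = D l′
      eq : suc k ℕ.+ l′ ℕ.* c′ ≡ g ℕ.* c′
      eq = sym (ℕ.*-distribʳ-+ c′ (suc l) l′)
      terms : ∀ i j → i ℕ.+ j ≡ suc l ℕ.* a ℕ.+ l′ ℕ.* a → i ≢ suc l ℕ.* a → K k i * B (l′ ℕ.* c′) j ≡ 0ℚ
      terms i j i+j≡ i≢la = K*B-zero k (l′ ℕ.* c′) eq i j (trans i+j≡ (sym (ℕ.*-distribʳ-+ a (suc l) l′)))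
        (λ ic≡ka → i≢la (ℕ.*-cancelʳ-≡ i (suc l ℕ.* a) c′ (trans ic≡ka
          (trans (ℕ.*-assoc (suc l) c′ a) (trans (cong (suc l ℕ.*_) (ℕ.*-comm c′ a)) (sym (ℕ.*-assoc (suc l) a c′)))))))

    F∘-block : ∀ j → j < g → ∀ r → r ≤ e → F∘ (r ℕ.+ j ℕ.* c′) ≡ F∘ (j ℕ.* c′)
    F∘-block j j<g zero    r≤e = refl
    F∘-block j j<g (suc r) r<e = trans (sym (F∘-const k (g ℕ.* c′ ∸ suc k) (ℕ.m+[n∸m]≡n k<gc) c∤k))
      (F∘-block j j<g r (ℕ.<⇒≤ r<e))
      where
      k : ℕ
      k = r ℕ.+ j ℕ.* c′
      k<gc : suc k ≤ g ℕ.* c′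
      k<gc = ℕ.≤-trans (ℕ.+-monoˡ-≤ (j ℕ.* c′) (ℕ.≤-trans r<e (ℕ.n≤1+n e))) (ℕ.*-monoˡ-≤ c′ j<g)
      c∤k : ¬ c′ ∣ suc k
      c∤k c∣k = >⇒∤ (s≤s r<e) (∣m+n∣m⇒∣n (subst (c′ ∣_) (ℕ.+-comm (suc r) (j ℕ.* c′)) c∣k) (n∣m*n j))

    -- The jumps telescope, starting from `D g` at `k = 0`. The case `j = g` is included for the
    -- sake of `q⊛D`.
    F-value : ∀ j → j ≤ g → F∘ (j ℕ.* c′) ≡ ∑ (suc j) (λ l → q l * D (g ∸ l))
    F-value zero    j≤g = trans (F-⊛ 0 (g ℕ.* c′) (g ℕ.* a)) (trans (⊛-identityˡ (B (g ℕ.* c′)) (g ℕ.* a))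
      (sym (trans (ℚ.+-identityʳ _) (ℚ.*-identityˡ (D g)))))
    F-value (suc j) j<g = begin
      F∘ (suc j ℕ.* c′)                                              ≡⟨ F∘-jump j (g ∸ suc j) (ℕ.m+[n∸m]≡n j<g) ⟨
      F∘ (e ℕ.+ j ℕ.* c′) + q (suc j) * D (g ∸ suc j)                ≡⟨ cong (_+ q (suc j) * D (g ∸ suc j)) (F∘-block j j<g e ℕ.≤-refl) ⟩
      F∘ (j ℕ.* c′) + q (suc j) * D (g ∸ suc j)                      ≡⟨ cong (_+ q (suc j) * D (g ∸ suc j)) (F-value j (ℕ.<⇒≤ j<g)) ⟩
      ∑ (suc j) (λ l → q l * D (g ∸ l)) + q (suc j) * D (g ∸ suc j)  ≡⟨ ∑-last (suc j) (λ l → q l * D (g ∸ l)) ⟨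
      ∑ (suc (suc j)) (λ l → q l * D (g ∸ l))                        ∎

  -- As many flaws as steps would make every point before the end a flaw, but the startpoint is on
  -- the line.
  F-full : ∀ g → F (suc g ℕ.* c′) (suc g ℕ.* c′) (suc g ℕ.* a) ≡ 0ℚ
  F-full g = begin
    F n n x                ≡⟨ cong (λ m → F n m x) (sym (ℕ.+-identityʳ n)) ⟩
    F n (n ℕ.+ 0) x        ≡⟨ F-⊛ n 0 x ⟩
    (A n ⊛ δ) x            ≡⟨ trans (⊛-comm (A n) δ x) (⊛-identityˡ (A n) x) ⟩
    A n x                  ≡⟨ A-≥ (e ℕ.+ g ℕ.* c′) x (ℕ.≤-reflexive ([ga]c≡[gc]a (suc g))) ⟩
    0ℚ                     ∎
    where
    n x : ℕ
    n = suc g ℕ.* c′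
    x = suc g ℕ.* a

  q⊛D : q ⊛ D ≈ δ
  q⊛D zero    = refl
  q⊛D (suc g) = trans (sym (F-value (suc g) (suc g) ℕ.≤-refl)) (F-full g)

  -- All words are counted by their flaws. The counts are constant on blocks of `c′` values of `k`,
  -- and adding up the block values, which are partial sums of `u`, produces the factor `g - l` of
  -- `θ D`.
  q⊛θD : ∀ g → toℚ c′ * (q ⊛ θ D) (suc g) ≡ toℚ ((suc g ℕ.* c′) C (suc g ℕ.* a))
  q⊛θD g′ = begin
    toℚ c′ * (q ⊛ θ D) g
      ≡⟨ cong (toℚ c′ *_) (∑-cong (suc g) (λ l _ →
          solve 3 (λ x y z → x :* (y :* z) := y :* (x :* z)) refl (q l) (toℚ (g ∸ l)) (D (g ∸ l)))) ⟩
    toℚ c′ * ∑ (suc g) (λ l → toℚ (g ∸ l) * u l)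
      ≡⟨ cong (toℚ c′ *_) (∑-partialSums g u) ⟨
    toℚ c′ * ∑ g (λ j → ∑ (suc j) u)
      ≡⟨ ∑-*ˡ g (toℚ c′) (λ j → ∑ (suc j) u) ⟨
    ∑ g (λ j → toℚ c′ * ∑ (suc j) u)
      ≡⟨ ∑-cong g (λ j j<g → trans (sym (∑-const c′ (∑ (suc j) u))) (∑-cong c′ (λ r r<c → block j j<g r (ℕ.≤-pred r<c)))) ⟩
    ∑ g (λ j → ∑ c′ (λ r → F (j ℕ.* c′ ℕ.+ r) n x))
      ≡⟨ ∑-blocks g c′ (λ k → F k n x) ⟨
    ∑ n (λ k → F k n x)
      -- The blocks cover `k < n`; the vanishing count at `k = n` completes the range of `F-total`.
      ≡⟨ ℚ.+-identityʳ (∑ n (λ k → F k n x)) ⟨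
    ∑ n (λ k → F k n x) + 0ℚ
      ≡⟨ cong (∑ n (λ k → F k n x) +_) (F-full g′) ⟨
    ∑ n (λ k → F k n x) + F n n x
      ≡⟨ ∑-last n (λ k → F k n x) ⟨
    ∑ (suc n) (λ k → F k n x)
      ≡⟨ F-total n x ⟩
    toℚ (n C x)
      ∎
    where
    g n x : ℕ
    g = suc g′
    n = g ℕ.* c′
    x = g ℕ.* a
    u : ℕ → ℚ
    u l = q l * D (g ∸ l)
    block : ∀ j → j < g → ∀ r → r ≤ e → ∑ (suc j) u ≡ F (j ℕ.* c′ ℕ.+ r) n x
    block j j<g r r≤e = sym (trans (cong (F∘ g) (ℕ.+-comm (j ℕ.* c′) r))
      (trans (F∘-block g j j<g r r≤e) (F-value g j (ℕ.<⇒≤ j<g))))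

-- Generating functions of weighted lists

gf : {A : Set} → List A → (A → ℕ) → (A → ℚ) → ℕ → ℚ
gf xs w f n = sumℚ (map (λ x → mono (w x) (f x) n) xs)

-- Turns the filtered sums over partitions into coefficients of series, which can be multiplied.
sumℚ-filter : {A : Set} (xs : List A) (w : A → ℕ) (f : A → ℚ) (n : ℕ) →
  sumℚ (map f (filter (λ x → w x ℕ.≟ n) xs)) ≡ gf xs w f n
sumℚ-filter []       w f n = refl
sumℚ-filter (x ∷ xs) w f n with w x ℕ.≟ n
... | yes refl = trans (cong (sumℚ ∘ map f) (filter-accept (λ x → w x ℕ.≟ n) refl))
    (cong₂ _+_ (sym (mono-≡ (w x) (f x))) (sumℚ-filter xs w f n))
... | no wx≢n  = trans (cong (sumℚ ∘ map f) (filter-reject (λ x → w x ℕ.≟ n) wx≢n))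
  (trans (sumℚ-filter xs w f n)
    (sym (trans (cong (_+ gf xs w f n) (mono-≢ (w x) (f x) n (wx≢n ∘ sym))) (ℚ.+-identityˡ (gf xs w f n)))))

gf-++ : {A : Set} (xs ys : List A) (w : A → ℕ) (f : A → ℚ) (n : ℕ) →
  gf (xs ++ ys) w f n ≡ gf xs w f n + gf ys w f n
gf-++ []       ys w f n = sym (ℚ.+-identityˡ (gf ys w f n))
gf-++ (x ∷ xs) ys w f n = trans (cong (mono (w x) (f x) n +_) (gf-++ xs ys w f n))
                                (sym (ℚ.+-assoc (mono (w x) (f x) n) _ _))

-- Only elements of weight `n` contribute in degree `n`, so `f` and `h` need to be compared only
-- there. This allows signs that depend on `n`.
gf-scale : {A : Set} (xs : List A) (w : A → ℕ) (f h : A → ℚ) (y : ℚ) (n : ℕ) →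
  (∀ x → w x ≡ n → y * f x ≡ h x) → y * gf xs w f n ≡ gf xs w h n
gf-scale []       w f h y n eq = ℚ.*-zeroʳ y
gf-scale (x ∷ xs) w f h y n eq =
  trans (ℚ.*-distribˡ-+ y (mono (w x) (f x) n) (gf xs w f n)) (cong₂ _+_ head (gf-scale xs w f h y n eq))
  where
  head : y * mono (w x) (f x) n ≡ mono (w x) (h x) n
  head with n ℕ.≟ w x
  ... | yes refl = trans (cong (y *_) (mono-≡ n (f x))) (trans (eq x refl) (sym (mono-≡ n (h x))))
  ... | no n≢wx  = trans (cong (y *_) (mono-≢ (w x) (f x) n n≢wx))
                     (trans (ℚ.*-zeroʳ y) (sym (mono-≢ (w x) (h x) n n≢wx)))

module _ {A B C : Set} (p : A → B → C)
  (w : A → ℕ) (u : B → ℕ) (z : C → ℕ) (f : A → ℚ) (h : B → ℚ) (k : C → ℚ)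
  (z-p : ∀ x y → z (p x y) ≡ w x ℕ.+ u y) (k-p : ∀ x y → k (p x y) ≡ f x * h y) where

  gf-map : ∀ x ys → gf (map (p x) ys) z k ≈ mono (w x) (f x) ⊛ gf ys u h
  gf-map x []       n = sym (⊛-zeroʳ (mono (w x) (f x)) n)
  gf-map x (y ∷ ys) n = begin
    mono (z (p x y)) (k (p x y)) n + gf (map (p x) ys) z k n
      ≡⟨ cong₂ _+_ (cong₂ (λ d r → mono d r n) (z-p x y) (k-p x y)) (gf-map x ys n) ⟩
    mono (w x ℕ.+ u y) (f x * h y) n + (mono (w x) (f x) ⊛ gf ys u h) n
      ≡⟨ cong (_+ (mono (w x) (f x) ⊛ gf ys u h) n) (mono-⊛-mono (w x) (u y) (f x) (h y) n) ⟨
    (mono (w x) (f x) ⊛ mono (u y) (h y)) n + (mono (w x) (f x) ⊛ gf ys u h) n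
      ≡⟨ ⊛-distribˡ (mono (w x) (f x)) (mono (u y) (h y)) (gf ys u h) n ⟨
    (mono (w x) (f x) ⊛ gf (y ∷ ys) u h) n
      ∎

  -- Weights add and values multiply under `p`. With `_∷_` for `p` this is how `vecs` is built, so
  -- its series factors over the part sizes.
  gf-× : ∀ xs ys → gf (concatMap (λ x → map (p x) ys) xs) z k ≈ gf xs w f ⊛ gf ys u h
  gf-× []       ys n = sym (⊛-zeroˡ (gf ys u h) n)
  gf-× (x ∷ xs) ys n = begin
    gf (map (p x) ys ++ concatMap (λ x → map (p x) ys) xs) z k n
      ≡⟨ gf-++ (map (p x) ys) (concatMap (λ x → map (p x) ys) xs) z k n ⟩
    gf (map (p x) ys) z k n + gf (concatMap (λ x → map (p x) ys) xs) z k n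
      ≡⟨ cong₂ _+_ (gf-map x ys n) (gf-× xs ys n) ⟩
    (mono (w x) (f x) ⊛ gf ys u h) n + (gf xs w f ⊛ gf ys u h) n
      ≡⟨ ⊛-distribʳ (mono (w x) (f x)) (gf xs w f) (gf ys u h) n ⟨
    (gf (x ∷ xs) w f ⊛ gf ys u h) n
      ∎

-- Sums over partitions

expCoeff : ℚ → ℕ → ℚ
expCoeff y m = pow y m * frac 1 (m !)

-- The differential equation of exp(yT), read off coefficientwise.
expCoeff-suc : ∀ y m → toℚ (suc m) * expCoeff y (suc m) ≡ y * expCoeff y m
expCoeff-suc y m = begin
  toℚ (suc m) * ((y * pow y m) * r)          ≡⟨ solve 4 (λ t y p r → t :* ((y :* p) :* r) := y :* (p :* (r :* t))) refl (toℚ (suc m)) y (pow y m) r ⟩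
  y * (pow y m * (r * toℚ (suc m)))          ≡⟨ cong (λ z → y * (pow y m * z)) r*[1+m] ⟩
  y * (pow y m * frac 1 (m !))               ∎
  where
  r : ℚ
  r = frac 1 (suc m !)
  r*[1+m] : r * toℚ (suc m) ≡ frac 1 (m !)
  r*[1+m] = toℚ-*-cancelˡ (m !) {{m ℕ.!≢0}} (begin
    toℚ (m !) * (r * toℚ (suc m))    ≡⟨ solve 3 (λ x y z → x :* (y :* z) := y :* (z :* x)) refl (toℚ (m !)) r (toℚ (suc m)) ⟩
    r * (toℚ (suc m) * toℚ (m !))    ≡⟨ cong (r *_) (toℚ-* (suc m) (m !)) ⟨
    r * toℚ (suc m !)                ≡⟨ frac-* 1 (suc m !) {{suc m ℕ.!≢0}} ⟩
    1ℚ                               ≡⟨ frac-* 1 (m !) {{m ℕ.!≢0}} ⟨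
    frac 1 (m !) * toℚ (m !)         ≡⟨ ℚ.*-comm (frac 1 (m !)) (toℚ (m !)) ⟩
    toℚ (m !) * frac 1 (m !)         ∎)

weight : (ℕ → ℚ) → ∀ {k} → ℕ → Vec ℕ k → ℚ
weight d s []       = 1ℚ
weight d s (m ∷ ms) = expCoeff (d s) m * weight d (suc s) ms

-- Bounding the multiplicities by b truncates the exponential series X s, so that logarithmic
-- derivatives are only correct up to degree b.
module PartitionSums (d : ℕ → ℚ) (b : ℕ) where

  X : ℕ → ℕ → ℚ
  X s = gf (upTo (suc b)) (s ℕ.*_) (expCoeff (d s))

  Z : ℕ → ℕ → ℕ → ℚ
  Z s k = gf (vecs k b) (weightFrom s) (weight d s)

  -- The sum of t d_t X^t over `s ≤ t < s + k`: the logarithmic derivative of the product of the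
  -- untruncated series exp(d_t X^t).
  logDeriv : ℕ → ℕ → ℕ → ℚ
  logDeriv s zero    i = 0ℚ
  logDeriv s (suc k) i = mono s (θ d s) i + logDeriv (suc s) k i

  X≡∑ : ∀ s n → X s n ≡ ∑ (suc b) (λ m → mono (s ℕ.* m) (expCoeff (d s) m) n)
  X≡∑ s n = cong sumℚ (map-upTo (λ m → mono (s ℕ.* m) (expCoeff (d s) m) n) (suc b))

  Z-suc : ∀ s k → Z s (suc k) ≈ X s ⊛ Z (suc s) k
  Z-suc s k = gf-× _∷_ (s ℕ.*_) (weightFrom (suc s)) (weightFrom s) (expCoeff (d s)) (weight d (suc s)) (weight d s)
    (λ _ _ → refl) (λ _ _ → refl) (upTo (suc b)) (vecs k b)

  -- By `expCoeff-suc` each term on the left is a shifted term on the right. The right side has one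
  -- term more, of degree `s + s * b`, which exceeds `b` as `s` is positive.
  θX : ∀ s n → n ≤ b → θ (X (suc s)) n ≡ (mono (suc s) (θ d (suc s)) ⊛ X (suc s)) n
  θX s′ n n≤b = begin
    toℚ n * X s n
      ≡⟨ cong (toℚ n *_) (X≡∑ s n) ⟩
    toℚ n * ∑ (suc b) (λ m → mono (s ℕ.* m) (x m) n)
      ≡⟨ ∑-*ˡ (suc b) (toℚ n) (λ m → mono (s ℕ.* m) (x m) n) ⟨
    ∑ (suc b) (λ m → θ (mono (s ℕ.* m) (x m)) n)
      ≡⟨ ∑-cong (suc b) (λ m _ → θ-mono (s ℕ.* m) (x m) n) ⟩
    mono (s ℕ.* 0) (toℚ (s ℕ.* 0) * x 0) n + ∑ b (λ m → mono (s ℕ.* suc m) (toℚ (s ℕ.* suc m) * x (suc m)) n)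
      ≡⟨ cong₂ _+_ first (∑-cong b (λ m _ → cong₂ (λ i z → mono i z n) (ℕ.*-suc s m) (coeff m))) ⟩
    0ℚ + ∑ b (λ m → mono (s ℕ.+ s ℕ.* m) (y * x m) n)
      ≡⟨ ℚ.+-comm 0ℚ (∑ b (λ m → mono (s ℕ.+ s ℕ.* m) (y * x m) n)) ⟩
    ∑ b (λ m → mono (s ℕ.+ s ℕ.* m) (y * x m) n) + 0ℚ
      ≡⟨ cong (∑ b (λ m → mono (s ℕ.+ s ℕ.* m) (y * x m) n) +_) last ⟨
    ∑ b (λ m → mono (s ℕ.+ s ℕ.* m) (y * x m) n) + mono (s ℕ.+ s ℕ.* b) (y * x b) n
      ≡⟨ ∑-last b (λ m → mono (s ℕ.+ s ℕ.* m) (y * x m) n) ⟨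
    ∑ (suc b) (λ m → mono (s ℕ.+ s ℕ.* m) (y * x m) n)
      ≡⟨ ∑-cong (suc b) (λ m _ → mono-⊛-mono s (s ℕ.* m) y (x m) n) ⟨
    ∑ (suc b) (λ m → (mono s y ⊛ mono (s ℕ.* m) (x m)) n)
      ≡⟨ ⊛-∑ʳ (suc b) (mono s y) (λ m → mono (s ℕ.* m) (x m)) n ⟨
    (mono s y ⊛ (λ i → ∑ (suc b) (λ m → mono (s ℕ.* m) (x m) i))) n
      ≡⟨ ⊛-cong (mono s y) (mono s y) (X s) (λ i → ∑ (suc b) (λ m → mono (s ℕ.* m) (x m) i)) (λ _ → refl) (X≡∑ s) n ⟨
    (mono s y ⊛ X s) n
      ∎
    where
    s : ℕ
    s = suc s′
    x : ℕ → ℚ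
    x = expCoeff (d s)
    y : ℚ
    y = θ d s
    first : mono (s ℕ.* 0) (toℚ (s ℕ.* 0) * x 0) n ≡ 0ℚ
    first = trans (cong (λ z → mono (s ℕ.* 0) z n)
              (trans (cong (λ z → toℚ z * x 0) (ℕ.*-zeroʳ s)) (ℚ.*-zeroˡ (x 0)))) (mono-0ℚ (s ℕ.* 0) n)
    last : mono (s ℕ.+ s ℕ.* b) (y * x b) n ≡ 0ℚ
    last = mono-≢ (s ℕ.+ s ℕ.* b) (y * x b) n (ℕ.<⇒≢ (s≤s (ℕ.≤-trans n≤b
             (ℕ.≤-trans (ℕ.m≤m+n b (s′ ℕ.* b)) (ℕ.m≤n+m (s ℕ.* b) s′)))))
    coeff : ∀ m → toℚ (s ℕ.* suc m) * x (suc m) ≡ y * x m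
    coeff m = begin
      toℚ (s ℕ.* suc m) * x (suc m)          ≡⟨ cong (_* x (suc m)) (toℚ-* s (suc m)) ⟩
      toℚ s * toℚ (suc m) * x (suc m)        ≡⟨ ℚ.*-assoc (toℚ s) (toℚ (suc m)) (x (suc m)) ⟩
      toℚ s * (toℚ (suc m) * x (suc m))      ≡⟨ cong (toℚ s *_) (expCoeff-suc (d s) m) ⟩
      toℚ s * (d s * x m)                    ≡⟨ ℚ.*-assoc (toℚ s) (d s) (x m) ⟨
      toℚ s * d s * x m                      ∎

  -- Logarithmic derivatives add over the factorization `Z-suc`. A coefficient of degree `n`
  -- involves only degrees up to `n`, so the bound is inherited.
  θZ : ∀ k s n → n ≤ b → θ (Z (suc s) k) n ≡ (logDeriv (suc s) k ⊛ Z (suc s) k) n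
  θZ zero    s n       n≤b = trans (θδ n) (sym (⊛-zeroˡ (Z (suc s) 0) n))
    where
    θδ : ∀ n → θ (Z (suc s) 0) n ≡ 0ℚ
    θδ zero    = refl
    θδ (suc n) = ℚ.*-zeroʳ (toℚ (suc n))
  θZ (suc k) s n n≤b = begin
    toℚ n * Z (suc s) (suc k) n
      ≡⟨ cong (toℚ n *_) (Z-suc (suc s) k n) ⟩
    θ (X₁ ⊛ Z₂) n
      ≡⟨ θ-⊛ X₁ Z₂ n ⟩
    (θ X₁ ⊛ Z₂) n + (X₁ ⊛ θ Z₂) n
      ≡⟨ cong₂ _+_ (⊛-cong-≤ (θ X₁) (M ⊛ X₁) Z₂ Z₂ n (λ i i≤n → θX s i (ℕ.≤-trans i≤n n≤b)) (λ _ _ → refl))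
                   (⊛-cong-≤ X₁ X₁ (θ Z₂) (L ⊛ Z₂) n (λ _ _ → refl) (λ i i≤n → θZ k (suc s) i (ℕ.≤-trans i≤n n≤b))) ⟩
    ((M ⊛ X₁) ⊛ Z₂) n + (X₁ ⊛ (L ⊛ Z₂)) n
      ≡⟨ cong₂ _+_ (⊛-assoc M X₁ Z₂ n) (⊛-swap X₁ L Z₂ n) ⟩
    (M ⊛ (X₁ ⊛ Z₂)) n + (L ⊛ (X₁ ⊛ Z₂)) n
      ≡⟨ ⊛-distribʳ M L (X₁ ⊛ Z₂) n ⟨
    (logDeriv (suc s) (suc k) ⊛ (X₁ ⊛ Z₂)) n
      ≡⟨ ⊛-cong (logDeriv (suc s) (suc k)) (logDeriv (suc s) (suc k)) (Z (suc s) (suc k)) (X₁ ⊛ Z₂) (λ _ → refl) (Z-suc (suc s) k) n ⟨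
    (logDeriv (suc s) (suc k) ⊛ Z (suc s) (suc k)) n
      ∎
    where
    X₁ Z₂ M L : ℕ → ℚ
    X₁ = X (suc s)
    Z₂ = Z (suc (suc s)) k
    M = mono (suc s) (θ d (suc s))
    L = logDeriv (suc (suc s)) k

  Z-0 : ∀ k s → Z (suc s) k 0 ≡ 1ℚ
  Z-0 zero    s = refl
  Z-0 (suc k) s = trans (Z-suc (suc s) k 0) (trans (ℚ.+-identityʳ _)
    (cong₂ _*_ (trans (X≡∑ (suc s) 0) (cong₂ _+_ (cong (λ z → mono z 1ℚ 0) (ℕ.*-zeroʳ s)) (∑-zero b (λ _ _ → refl)))) (Z-0 k (suc s))))

  logDeriv-< : ∀ k s i → i < s → logDeriv s k i ≡ 0ℚ
  logDeriv-< zero    s i i<s = refl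
  logDeriv-< (suc k) s i i<s = cong₂ _+_ (mono-≢ s (θ d s) i (ℕ.<⇒≢ i<s)) (logDeriv-< k (suc s) i (ℕ.m<n⇒m<1+n i<s))

  logDeriv-≥ : ∀ k s i → s ≤ i → i < s ℕ.+ k → logDeriv s k i ≡ θ d i
  logDeriv-≥ zero    s i s≤i i<s+k = contradiction (subst (i <_) (ℕ.+-identityʳ s) i<s+k) (ℕ.≤⇒≯ s≤i)
  logDeriv-≥ (suc k) s i s≤i i<s+k with i ℕ.≟ s
  ... | yes refl = trans (cong₂ _+_ (mono-≡ i (θ d i)) (logDeriv-< k (suc i) i ℕ.≤-refl)) (ℚ.+-identityʳ (θ d i))
  ... | no  i≢s  = trans (cong₂ _+_ (mono-≢ s (θ d s) i i≢s)
                     (logDeriv-≥ k (suc s) i (ℕ.≤∧≢⇒< s≤i (i≢s ∘ sym)) (subst (i <_) (ℕ.+-suc s k) i<s+k)))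
                     (ℚ.+-identityˡ (θ d i))

  -- Up to degree `b` neither the bound on the parts nor that on the multiplicities is felt, so
  -- `Z 1 b` satisfies the same equation as `f`.
  Z-unique : ∀ (f : ℕ → ℚ) → f 0 ≡ 1ℚ → θ f ≈ θ d ⊛ f → Z 1 b b ≡ f b
  Z-unique f f0 θf = θ-unique b (θ d) (Z 1 b) f (ℚ.*-zeroˡ (d 0)) (trans (Z-0 b 0) (sym f0))
    (λ n n≤b → trans (θZ b 0 n n≤b) (⊛-cong-≤ (logDeriv 1 b) (θ d) (Z 1 b) (Z 1 b) n
      (λ i i≤n → logDeriv≡ i (ℕ.≤-trans i≤n n≤b)) (λ _ _ → refl)))
    (λ n _ → θf n) b ℕ.≤-refl
    where
    logDeriv≡ : ∀ i → i ≤ b → logDeriv 1 b i ≡ θ d i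
    logDeriv≡ zero    i≤b = trans (logDeriv-< b 1 0 (s≤s z≤n)) (sym (ℚ.*-zeroˡ (d 0)))
    logDeriv≡ (suc i) i≤b = logDeriv-≥ b 1 (suc i) (s≤s z≤n) (s≤s i≤b)

-- `H` and the signed `E` as partition sums with weights `c` and `- c`

cλFrom≡weight : ∀ a b {k} s (v : Vec ℕ k) → cλFrom a b s v ≡ weight (c a b) s v
cλFrom≡weight a b s []       = refl
cλFrom≡weight a b s (m ∷ ms) = cong (expCoeff (c a b s) m *_) (cλFrom≡weight a b (suc s) ms)

H≡Z : ∀ a b n → H a b n ≡ PartitionSums.Z (c a b) n 1 n n
H≡Z a b n = trans (sumℚ-filter (vecs n n) (weightFrom 1) (cλ a b) n)
  -- The factor `1ℚ` lets `gf-scale` serve as a congruence.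
  (trans (sym (ℚ.*-identityˡ _)) (gf-scale (vecs n n) (weightFrom 1) (cλ a b) (weight (c a b) 1) 1ℚ n
    (λ v _ → trans (ℚ.*-identityˡ (cλ a b v)) (cλFrom≡weight a b 1 v))))

sgn-+ : ∀ m n → sgn (m ℕ.+ n) ≡ sgn m * sgn n
sgn-+ zero    n = sym (ℚ.*-identityˡ (sgn n))
sgn-+ (suc m) n = trans (cong -_ (sgn-+ m n)) (ℚ.neg-distribˡ-* (sgn m) (sgn n))

sgn-² : ∀ n → sgn n * sgn n ≡ 1ℚ
sgn-² zero    = refl
sgn-² (suc n) = trans (solve 1 (λ x → (:- x) :* (:- x) := x :* x) refl (sgn n)) (sgn-² n)

-- With l = l(λ), the factor (-1)^n turns the sign in `E` into (-1)^l(λ), which is multiplicative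
-- over the parts.
sgn-∸ : ∀ n l → l ≤ n → sgn n * sgn (n ∸ l) ≡ sgn l
sgn-∸ n l l≤n = begin
  sgn n * sgn r              ≡⟨ cong (λ z → sgn z * sgn r) (sym (ℕ.m+[n∸m]≡n l≤n)) ⟩
  sgn (l ℕ.+ r) * sgn r      ≡⟨ cong (_* sgn r) (sgn-+ l r) ⟩
  sgn l * sgn r * sgn r      ≡⟨ ℚ.*-assoc (sgn l) (sgn r) (sgn r) ⟩
  sgn l * (sgn r * sgn r)    ≡⟨ cong (sgn l *_) (sgn-² r) ⟩
  sgn l * 1ℚ                 ≡⟨ ℚ.*-identityʳ (sgn l) ⟩
  sgn l                      ∎
  where
  r : ℕ
  r = n ∸ l

pow-neg : ∀ x m → pow (- x) m ≡ sgn m * pow x m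
pow-neg x zero    = refl
pow-neg x (suc m) = trans (cong (- x *_) (pow-neg x m))
  (solve 3 (λ x s p → (:- x) :* (s :* p) := (:- s) :* (x :* p)) refl x (sgn m) (pow x m))

-- One sign goes to each part, which turns every `c` into `- c`.
sgn-len-cλFrom : ∀ a b {k} s (v : Vec ℕ k) →
  sgn (len v) * cλFrom a b s v ≡ weight (λ i → - c a b i) s v
sgn-len-cλFrom a b s []       = refl
sgn-len-cλFrom a b s (m ∷ ms) = begin
  sgn (m ℕ.+ len ms) * (p * r * cλFrom a b (suc s) ms)
    ≡⟨ cong (_* (p * r * cλFrom a b (suc s) ms)) (sgn-+ m (len ms)) ⟩
  sgn m * sgn (len ms) * (p * r * cλFrom a b (suc s) ms)
    ≡⟨ solve 5 (λ t u p r z → t :* u :* (p :* r :* z) := t :* p :* r :* (u :* z)) refl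
         (sgn m) (sgn (len ms)) p r (cλFrom a b (suc s) ms) ⟩
  sgn m * p * r * (sgn (len ms) * cλFrom a b (suc s) ms)
    ≡⟨ cong₂ _*_ (cong (_* r) (sym (pow-neg (c a b s) m))) (sgn-len-cλFrom a b (suc s) ms) ⟩
  pow (- c a b s) m * r * weight (λ i → - c a b i) (suc s) ms
    ∎
  where
  p r : ℚ
  p = pow (c a b s) m
  r = frac 1 (m !)

-- All parts are at least 1. This makes the truncated subtraction in `E` exact.
len≤weightFrom : ∀ {k} s (v : Vec ℕ k) → len v ≤ weightFrom (suc s) v
len≤weightFrom s []       = z≤n
len≤weightFrom s (m ∷ ms) = ℕ.+-mono-≤ (ℕ.m≤m+n m (s ℕ.* m)) (len≤weightFrom (suc s) ms)

sgn*E≡Z : ∀ a b n → sgn n * E a b n ≡ PartitionSums.Z (λ i → - c a b i) n 1 n n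
sgn*E≡Z a b zero       = refl
sgn*E≡Z a b n@(suc _) = trans (cong (sgn n *_) (sumℚ-filter (vecs n n) (weightFrom 1) f n))
  (gf-scale (vecs n n) (weightFrom 1) f (weight (λ i → - c a b i) 1) (sgn n) n signs)
  where
  f : Vec ℕ n → ℚ
  f v = sgn (n ∸ len v) * cλ a b v
  signs : ∀ v → weightFrom 1 v ≡ n → sgn n * f v ≡ weight (λ i → - c a b i) 1 v
  signs v w≡n = begin
    sgn n * (sgn (n ∸ len v) * cλ a b v)    ≡⟨ ℚ.*-assoc (sgn n) (sgn (n ∸ len v)) (cλ a b v) ⟨
    sgn n * sgn (n ∸ len v) * cλ a b v      ≡⟨ cong (_* cλ a b v) (sgn-∸ n (len v) (subst (len v ≤_) w≡n (len≤weightFrom 0 v))) ⟩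
    sgn (len v) * cλ a b v                  ≡⟨ sgn-len-cλFrom a b 1 v ⟩
    weight (λ i → - c a b i) 1 v            ∎

-- Counting words

module _ {A : Set} where

  count : (s t : A → ℕ) → ℕ → ℕ → List A → ℕ
  count s t k x ws = length (filter (λ w → s w ℕ.≟ k) (filter (λ w → t w ℕ.≟ x) ws))

  count-++ : ∀ s t k x vs ws → count s t k x (vs ++ ws) ≡ count s t k x vs ℕ.+ count s t k x ws
  count-++ s t k x vs ws = begin
    count s t k x (vs ++ ws)
      ≡⟨ cong (length ∘ filter (λ w → s w ℕ.≟ k)) (filter-++ (λ w → t w ℕ.≟ x) vs ws) ⟩
    length (filter (λ w → s w ℕ.≟ k) (filter (λ w → t w ℕ.≟ x) vs ++ filter (λ w → t w ℕ.≟ x) ws))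
      ≡⟨ cong length (filter-++ (λ w → s w ℕ.≟ k) (filter (λ w → t w ℕ.≟ x) vs) (filter (λ w → t w ℕ.≟ x) ws)) ⟩
    length (filter (λ w → s w ℕ.≟ k) (filter (λ w → t w ℕ.≟ x) vs) ++ filter (λ w → s w ℕ.≟ k) (filter (λ w → t w ℕ.≟ x) ws))
      ≡⟨ length-++ (filter (λ w → s w ℕ.≟ k) (filter (λ w → t w ℕ.≟ x) vs)) ⟩
    count s t k x vs ℕ.+ count s t k x ws
      ∎

  filter-map-≡ : ∀ (s s′ : A → ℕ) i k (f : A → A) → (∀ w → s (f w) ≡ i ℕ.+ s′ w) → ∀ ws →
    filter (λ w → s w ℕ.≟ i ℕ.+ k) (map f ws) ≡ map f (filter (λ w → s′ w ℕ.≟ k) ws)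
  filter-map-≡ s s′ i k f eq []       = refl
  filter-map-≡ s s′ i k f eq (w ∷ ws) with s′ w ℕ.≟ k
  ... | yes s′w≡k = trans (filter-accept (λ w → s w ℕ.≟ i ℕ.+ k) (trans (eq w) (cong (i ℕ.+_) s′w≡k)))
    (trans (cong (f w ∷_) (filter-map-≡ s s′ i k f eq ws))
      (cong (map f) (sym (filter-accept (λ w → s′ w ℕ.≟ k) s′w≡k))))
  ... | no  s′w≢k = trans (filter-reject (λ w → s w ℕ.≟ i ℕ.+ k) (s′w≢k ∘ ℕ.+-cancelˡ-≡ i _ _ ∘ trans (sym (eq w))))
    (trans (filter-map-≡ s s′ i k f eq ws)
      (cong (map f) (sym (filter-reject (λ w → s′ w ℕ.≟ k) s′w≢k))))

  -- Meant for prefixing a step: `i` is the contribution of the current point to the flaws, `y` that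
  -- of the step to the east steps.
  count-map : ∀ (s s′ t t′ : A → ℕ) i k y x (f : A → A) →
    (∀ w → s (f w) ≡ i ℕ.+ s′ w) → (∀ w → t (f w) ≡ y ℕ.+ t′ w) → ∀ ws →
    count s t (i ℕ.+ k) (y ℕ.+ x) (map f ws) ≡ count s′ t′ k x ws
  count-map s s′ t t′ i k y x f es et ws = begin
    length (filter (λ w → s w ℕ.≟ i ℕ.+ k) (filter (λ w → t w ℕ.≟ y ℕ.+ x) (map f ws)))
      ≡⟨ cong (length ∘ filter (λ w → s w ℕ.≟ i ℕ.+ k)) (filter-map-≡ t t′ y x f et ws) ⟩
    length (filter (λ w → s w ℕ.≟ i ℕ.+ k) (map f (filter (λ w → t′ w ℕ.≟ x) ws)))
      ≡⟨ cong length (filter-map-≡ s s′ i k f es (filter (λ w → t′ w ℕ.≟ x) ws)) ⟩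
    length (map f (filter (λ w → s′ w ℕ.≟ k) (filter (λ w → t′ w ℕ.≟ x) ws)))
      ≡⟨ length-map f (filter (λ w → s′ w ℕ.≟ k) (filter (λ w → t′ w ℕ.≟ x) ws)) ⟩
    count s′ t′ k x ws
      ∎

-- Flaws of words and the recurrence for `F`

module Words (a′ b : ℕ) (coprime : Coprime (suc (a′ ℕ.+ b)) (suc a′)) (g′ : ℕ) where

  open Ballot (suc a′) (a′ ℕ.+ b) coprime

  a g P Q : ℕ
  a = suc a′
  g = suc g′
  P = g ℕ.* a
  Q = g ℕ.* b

  words : ℕ → ℕ → ℕ → ℕ → ℕ → ℕ
  words k n x x₀ y₀ = count (flawsFrom P Q x₀ y₀) countTrue k x (allWords n)

  module _ (n x x₀ y₀ : ℕ) (ex : x₀ ℕ.+ x ≡ P) (en : x₀ ℕ.+ y₀ ℕ.+ n ≡ g ℕ.* c′) where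

    -- As the endpoint is on the line, `n * a - x * c′` equals `x₀ * b - y₀ * a`, here without
    -- subtraction. So the test by remaining steps agrees with the test by coordinates in `above`.
    remaining : n ℕ.* a ℕ.+ y₀ ℕ.* a ≡ x ℕ.* c′ ℕ.+ x₀ ℕ.* b
    remaining = ℕ.+-cancelʳ-≡ (x₀ ℕ.* a) _ _ (begin
      n ℕ.* a ℕ.+ y₀ ℕ.* a ℕ.+ x₀ ℕ.* a
        ≡⟨ ℕsolve 4 (λ n y x a → n :*: a :+: y :*: a :+: x :*: a :=: (x :+: y :+: n) :*: a) refl n y₀ x₀ a ⟩
      (x₀ ℕ.+ y₀ ℕ.+ n) ℕ.* a
        ≡⟨ cong (ℕ._* a) en ⟩
      g ℕ.* c′ ℕ.* a
        ≡⟨ [ga]c≡[gc]a g ⟨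
      P ℕ.* c′
        ≡⟨ cong (ℕ._* c′) ex ⟨
      (x₀ ℕ.+ x) ℕ.* (a ℕ.+ b)
        ≡⟨ ℕsolve 4 (λ z x a b → (z :+: x) :*: (a :+: b) :=: x :*: (a :+: b) :+: z :*: b :+: z :*: a) refl x₀ x a b ⟩
      x ℕ.* c′ ℕ.+ x₀ ℕ.* b ℕ.+ x₀ ℕ.* a
        ∎)
      where open ℕ.+-*-Solver using () renaming (solve to ℕsolve; _:+_ to _:+:_; _:*_ to _:*:_; _:=_ to _:=:_)

    scale : ∀ z w → z ℕ.* (g ℕ.* w) ≡ g ℕ.* (z ℕ.* w)
    scale z w = trans (sym (ℕ.*-assoc z g w)) (trans (cong (ℕ._* w) (ℕ.*-comm z g)) (ℕ.*-assoc g z w))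

    above-1 : n ℕ.* a < x ℕ.* c′ → above P Q x₀ y₀ ≡ 1
    above-1 lt with x₀ ℕ.* Q <ᵇ y₀ ℕ.* P | ℕ.<⇒<ᵇ (subst₂ _<_ (sym (scale x₀ b)) (sym (scale y₀ a)) (ℕ.*-monoʳ-< g x₀b<y₀a))
      where
      x₀b<y₀a : x₀ ℕ.* b < y₀ ℕ.* a
      x₀b<y₀a = ℕ.≰⇒> λ le → ℕ.<⇒≢ (ℕ.+-mono-<-≤ lt le) remaining
    ... | true | _ = refl

    above-0 : x ℕ.* c′ ≤ n ℕ.* a → above P Q x₀ y₀ ≡ 0
    above-0 ge with x₀ ℕ.* Q <ᵇ y₀ ℕ.* P in eq
    ... | false = refl
    ... | true  = contradiction (sym remaining) (ℕ.<⇒≢ (ℕ.+-mono-≤-< ge (ℕ.*-cancelˡ-< g _ _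
            (subst₂ _<_ (scale x₀ b) (scale y₀ a) (ℕ.<ᵇ⇒< _ _ (subst T (sym eq) _))))))

  module _ (n x₀ y₀ k : ℕ) (f : ℕ → ℚ) where

    -- The words are split by their first step: a north step keeps `x`, an east step lowers it by
    -- one, which is the `shift` in `W`.
    words-suc : ∀ i x → above P Q x₀ y₀ ≡ i → x₀ ℕ.+ x ≡ P →
      (∀ z → x₀ ℕ.+ z ≡ P → toℚ (words k n z x₀ (suc y₀)) ≡ f z) →
      (∀ z → suc x₀ ℕ.+ z ≡ P → toℚ (words k n z (suc x₀) y₀) ≡ f z) →
      toℚ (words (i ℕ.+ k) (suc n) x x₀ y₀) ≡ W f x
    words-suc i x ab ex north east = begin
      toℚ (words (i ℕ.+ k) (suc n) x x₀ y₀)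
        ≡⟨ cong toℚ (count-++ (flawsFrom P Q x₀ y₀) countTrue (i ℕ.+ k) x (map (true ∷_) (allWords n)) (map (false ∷_) (allWords n))) ⟩
      toℚ (E₁ ℕ.+ count (flawsFrom P Q x₀ y₀) countTrue (i ℕ.+ k) x (map (false ∷_) (allWords n)))
        ≡⟨ cong (λ z → toℚ (E₁ ℕ.+ z)) (count-map (flawsFrom P Q x₀ y₀) (flawsFrom P Q x₀ (suc y₀)) countTrue countTrue
            i k 0 x (false ∷_) (λ w → cong (ℕ._+ flawsFrom P Q x₀ (suc y₀) w) ab) (λ _ → refl) (allWords n)) ⟩
      toℚ (E₁ ℕ.+ words k n x x₀ (suc y₀))
        ≡⟨ toℚ-+ E₁ (words k n x x₀ (suc y₀)) ⟩
      toℚ E₁ + toℚ (words k n x x₀ (suc y₀))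
        ≡⟨ cong₂ _+_ (eastern x ex) (north x ex) ⟩
      shift f x + f x
        ≡⟨ ℚ.+-comm (shift f x) (f x) ⟩
      W f x
        ∎
      where
      E₁ : ℕ
      E₁ = count (flawsFrom P Q x₀ y₀) countTrue (i ℕ.+ k) x (map (true ∷_) (allWords n))
      eastern : ∀ x → x₀ ℕ.+ x ≡ P →
        toℚ (count (flawsFrom P Q x₀ y₀) countTrue (i ℕ.+ k) x (map (true ∷_) (allWords n))) ≡ shift f x
      eastern zero    ex = cong (toℚ ∘ length ∘ filter (λ w → flawsFrom P Q x₀ y₀ w ℕ.≟ i ℕ.+ k))
        (filter-none (λ w → countTrue w ℕ.≟ 0) (All.map⁺ (All.universal (λ _ ()) (allWords n))))
      eastern (suc x) ex = trans
        (cong toℚ (count-map (flawsFrom P Q x₀ y₀) (flawsFrom P Q (suc x₀) y₀) countTrue countTrue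
          i k 1 x (true ∷_) (λ w → cong (ℕ._+ flawsFrom P Q (suc x₀) y₀ w) ab) (λ _ → refl) (allWords n)))
        (east x (trans (sym (ℕ.+-suc x₀ x)) ex))

  -- By `above-0` and `above-1` both sides obey the same recursion on the number of remaining steps.
  words≡F : ∀ n k x x₀ y₀ → x₀ ℕ.+ x ≡ P → x₀ ℕ.+ y₀ ℕ.+ n ≡ g ℕ.* c′ → toℚ (words k n x x₀ y₀) ≡ F k n x
  -- The endpoint is examined too, but lies on the line and is no flaw.
  words≡F zero zero    zero    x₀ y₀ ex en =
    cong (toℚ ∘ length) (filter-accept (λ w → flawsFrom P Q x₀ y₀ w ℕ.≟ 0) {x = []} {xs = []} (above-0 0 0 x₀ y₀ ex en z≤n))
  words≡F zero (suc k) zero    x₀ y₀ ex en =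
    cong (toℚ ∘ length) (filter-reject (λ w → flawsFrom P Q x₀ y₀ w ℕ.≟ suc k) {x = []} {xs = []}
      (λ eq → ℕ.0≢1+n (trans (sym (above-0 0 0 x₀ y₀ ex en z≤n)) eq)))
  words≡F zero zero    (suc x) x₀ y₀ ex en = refl
  words≡F zero (suc k) (suc x) x₀ y₀ ex en = refl
  words≡F (suc n) k    x       x₀ y₀ ex en = by-position k (ℕ.<-≤-connex (suc n ℕ.* a) (x ℕ.* c′))
    where
    north : ∀ k z → x₀ ℕ.+ z ≡ P → toℚ (words k n z x₀ (suc y₀)) ≡ F k n z
    north k z ez = words≡F n k z x₀ (suc y₀) ez
      (trans (cong (ℕ._+ n) (ℕ.+-suc x₀ y₀)) (trans (sym (ℕ.+-suc (x₀ ℕ.+ y₀) n)) en))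
    east : ∀ k z → suc x₀ ℕ.+ z ≡ P → toℚ (words k n z (suc x₀) y₀) ≡ F k n z
    east k z ez = words≡F n k z (suc x₀) y₀ ez (trans (sym (ℕ.+-suc (x₀ ℕ.+ y₀) n)) en)
    flawed : suc n ℕ.* a < x ℕ.* c′ → ∀ w → flawsFrom P Q x₀ y₀ w ≢ 0
    flawed lt []          eq = ℕ.0≢1+n (trans (sym eq) (above-1 (suc n) x x₀ y₀ ex en lt))
    flawed lt (true ∷ w)  eq = ℕ.0≢1+n (trans (sym eq) (cong (ℕ._+ flawsFrom P Q (suc x₀) y₀ w) (above-1 (suc n) x x₀ y₀ ex en lt)))
    flawed lt (false ∷ w) eq = ℕ.0≢1+n (trans (sym eq) (cong (ℕ._+ flawsFrom P Q x₀ (suc y₀) w) (above-1 (suc n) x x₀ y₀ ex en lt)))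
    by-position : ∀ k → suc n ℕ.* a < x ℕ.* c′ ⊎ x ℕ.* c′ ≤ suc n ℕ.* a →
      toℚ (words k (suc n) x x₀ y₀) ≡ F k (suc n) x
    by-position k       (inj₂ ge) = trans
      (words-suc n x₀ y₀ k (F k n) 0 x (above-0 (suc n) x x₀ y₀ ex en ge) ex (north k) (east k))
      (sym (F-≥ k n x ge))
    -- The current point is already a flaw, so no completion has 0 flaws.
    by-position zero    (inj₁ lt) = trans
      (cong (toℚ ∘ length) (filter-none (λ w → flawsFrom P Q x₀ y₀ w ℕ.≟ 0)
        (All.universal (flawed lt) (filter (λ w → countTrue w ℕ.≟ x) (allWords (suc n))))))
      (sym (branch-< {suc n} {x} lt))
    by-position (suc k) (inj₁ lt) = trans
      (words-suc n x₀ y₀ k (F k n) 1 x (above-1 (suc n) x x₀ y₀ ex en lt) ex (north k) (east k))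
      (sym (branch-< {suc n} {x} lt))

-- Identification of `H` with `D` and of the signed `E` with `q`

module Bizley (a′ b : ℕ) (coprime : Coprime (suc (a′ ℕ.+ b)) (suc a′)) where

  open Ballot (suc a′) (a′ ℕ.+ b) coprime

  a : ℕ
  a = suc a′

  -- `c` divides the binomial coefficient by `i * c′`; `θ` cancels the `i`, and `q⊛θD` accounts for
  -- the `c′`.
  q⊛θD≈θc : q ⊛ θ D ≈ θ (c a b)
  q⊛θD≈θc zero    = refl
  q⊛θD≈θc (suc i) = toℚ-*-cancelˡ c′ (begin
    toℚ c′ * (q ⊛ θ D) (suc i)                  ≡⟨ q⊛θD i ⟩
    toℚ m                                       ≡⟨ frac-* m (suc i ℕ.* c′) ⟨
    r * toℚ (suc i ℕ.* c′)                      ≡⟨ cong (r *_) (toℚ-* (suc i) c′) ⟩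
    r * (toℚ (suc i) * toℚ c′)                  ≡⟨ solve 3 (λ x y z → x :* (y :* z) := z :* (y :* x)) refl r (toℚ (suc i)) (toℚ c′) ⟩
    toℚ c′ * (toℚ (suc i) * r)                  ∎)
    where
    m : ℕ
    m = (suc i ℕ.* c′) C (suc i ℕ.* a)
    r : ℚ
    r = frac m (suc i ℕ.* c′)

  H≡D : ∀ n → H a b n ≡ D n
  H≡D n = trans (H≡Z a b n) (PartitionSums.Z-unique (c a b) n D refl
    (θ-of-inverse D q (θ (c a b)) q⊛D q⊛θD≈θc))

  sgn*E≡q : ∀ n → sgn n * E a b n ≡ q n
  sgn*E≡q n = trans (sgn*E≡Z a b n) (PartitionSums.Z-unique (λ i → - c a b i) n q refl
    (λ i → trans (θ-inverse D q (θ (c a b)) q⊛D q⊛θD≈θc i)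
      (⊛-cong (λ n → - θ (c a b) n) (θ (λ i → - c a b i)) q q
        (λ n → ℚ.neg-distribʳ-* (toℚ n) (c a b n)) (λ _ → refl) i)))

  rhs≡∑ : ∀ g j → rhs a b g j ≡ ∑ (suc j) (λ l → q l * D (g ∸ l))
  rhs≡∑ g j = trans (cong sumℚ (map-upTo (λ k → (sgn k * E a b k) * H a b (g ∸ k)) (suc j)))
    (∑-cong (suc j) (λ k _ → cong₂ _*_ (sgn*E≡q k) (H≡D (g ∸ k))))

theorem1p12 : (a b : ℕ) → 0 < a → 0 < b → Coprime a b →
    (g : ℕ) → 0 < g → (j : ℕ) → j < g →
    toℚ (μ a b g j) ≡ rhs a b g j
theorem1p12 a@(suc a′) b _ _ coprime g@(suc g′) _ j j<g = begin
  -- At the origin all steps remain, and `μ` is by definition an instance of `words`.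
  toℚ (μ a b g j)                                  ≡⟨ words≡F (g ℕ.* (a ℕ.+ b)) (j ℕ.* (a ℕ.+ b)) (g ℕ.* a) 0 0 refl refl ⟩
  F (j ℕ.* (a ℕ.+ b)) (g ℕ.* (a ℕ.+ b)) (g ℕ.* a)  ≡⟨ F-value g j (ℕ.<⇒≤ j<g) ⟩
  ∑ (suc j) (λ l → q l * D (g ∸ l))                ≡⟨ rhs≡∑ g j ⟨
  rhs a b g j                                      ∎
  where
  coprime′ : Coprime (a ℕ.+ b) a
  coprime′ = coprime-+ (Coprime.sym coprime)
  open Ballot a (a′ ℕ.+ b) coprime′
  open Words a′ b coprime′ g′ using (words≡F)
  open Bizley a′ b coprime′ using (rhs≡∑)
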